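{- Consider the rotor-router growth model on $\mathbb{Z}^2$ with any total ordering $\epsilon_0<\epsilon_1<\epsilon_2<\epsilon_3$ of $E_2=\{\pm e_1,\pm e_2\}$. Let $\epsilon>0$. If $m$ is sufficiently large (depending on $\epsilon$), then after $m$ particles have been deposited and allowed to equilibrate, every site of $\mathbb{Z}^2$ in the open disc centered at the origin of radius $r_0=\left(\frac{8m}{3e^{6+\epsilon}}\right)^{1/4}$ is occupied.
   Context: Growth process: initially no site is occupied; each particle is placed at the origin; while it is at an occupied site $x$ it moves to $x+(\text{rotor direction at }x)$ and the rotor at $x$ is then advanced to the next direction in the cyclic order $\epsilon_0\to\epsilon_1\to\epsilon_2\to\epsilon_3\to\epsilon_0$; when it reaches an unoccupied site it stops there and that site becomes occupied with rotor $\epsilon_0$. Particles are deposited one at a time, each one moving until it stops before the next is deposited. -}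

module Defs where

open import Data.Nat as ℕ using (ℕ; zero; suc)
open import Data.Integer as ℤ using (ℤ; +_)
open import Data.Rational as ℚ using (ℚ; _/_; 0ℚ)
open import Data.Fin using (Fin; zero; suc)
open import Data.Maybe using (Maybe; just; nothing)
open import Data.Product using (_×_; _,_; ∃)
open import Data.Product.Properties using (≡-dec)
open import Relation.Nullary using (yes; no)
open import Relation.Binary.PropositionalEquality using (_≡_)
open import Function.Definitions using (Injective)

Site : Set
Site = ℤ × ℤ

origin : Site
origin = (+ 0 , + 0)

data Dir : Set where
  +e₁ -e₁ +e₂ -e₂ : Dir

vec : Dir → Site
vec +e₁ = (+ 1 , + 0)
vec -e₁ = (ℤ.- (+ 1) , + 0)
vec +e₂ = (+ 0 , + 1)
vec -e₂ = (+ 0 , ℤ.- (+ 1))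

_⊕_ : Site → Site → Site
(a , b) ⊕ (c , d) = (a ℤ.+ c , b ℤ.+ d)

-- A total ordering ε₀ < ε₁ < ε₂ < ε₃ of E₂ is given by an injective (hence
-- bijective) map ord : Fin 4 → Dir with ε_i = ord i (see Statement).

next : Fin 4 → Fin 4
next zero = suc zero
next (suc zero) = suc (suc zero)
next (suc (suc zero)) = suc (suc (suc zero))
next (suc (suc (suc zero))) = zero

-- A configuration: nothing = unoccupied, just i = occupied with rotor ε_i.
State : Set
State = Site → Maybe (Fin 4)

empty : State
empty _ = nothing

_≟ₛ_ : (x y : Site) → Relation.Nullary.Dec (x ≡ y)
_≟ₛ_ = ≡-dec ℤ._≟_ ℤ._≟_

update : State → Site → Maybe (Fin 4) → State
update σ x v y with y ≟ₛ x
... | yes _ = v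
... | no _ = σ y

Occupied : State → Site → Set
Occupied σ x = ∃ λ i → σ x ≡ just i

data Walk (ord : Fin 4 → Dir) : State → Site → State → Set where
  stop : ∀ {σ x} → σ x ≡ nothing → Walk ord σ x (update σ x (just zero))
  move : ∀ {σ x σ' i} → σ x ≡ just i →
         Walk ord (update σ x (just (next i))) (x ⊕ vec (ord i)) σ' →
         Walk ord σ x σ'

data Deposited (ord : Fin 4 → Dir) : ℕ → State → Set where
  init : Deposited ord 0 empty
  add  : ∀ {m σ σ'} → Deposited ord m σ → Walk ord σ origin σ' →
         Deposited ord (suc m) σ'

_^ℚ_ : ℚ → ℕ → ℚ
q ^ℚ zero = ℚ.1ℚ
q ^ℚ suc n = q ℚ.* (q ^ℚ n)

ℕ→ℚ : ℕ → ℚ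
ℕ→ℚ n = + n / 1

ℤ→ℚ : ℤ → ℚ
ℤ→ℚ z = z / 1

normSq : Site → ℚ
normSq (a , b) = ℤ→ℚ (a ℤ.* a ℤ.+ b ℤ.* b)

-- Note: for n > y, (n/(n-y))^n = (1 - y/n)^(-n) decreases strictly to e^y, so
-- for rational q:  e^y < q  iff  ∃ n > y, n^n < q · (n-y)^n.
-- x lies in the open disc of radius r₀ = (8m / (3 e^(6+ε)))^(1/4):
--   |x| < r₀  ⟺  3 |x|⁴ e^(6+ε) < 8m  ⟺  e^(6+ε) · 3|x|⁴ < 8m,
-- expressed (without division) as: ∃ n > 6+ε,
--   3 |x|⁴ · n^n < 8m · (n - (6+ε))^n.
InDisc : ℕ → ℚ → Site → Set
InDisc m ε x = ∃ λ (n : ℕ) → (y ℚ.< ℕ→ℚ n) ×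
  ((ℕ→ℚ 3 ℚ.* (normSq x ^ℚ 2)) ℚ.* (ℕ→ℚ n ^ℚ n)
     ℚ.< (ℕ→ℚ (8 ℕ.* m)) ℚ.* ((ℕ→ℚ n ℚ.- y) ^ℚ n))
  where y = ℕ→ℚ 6 ℚ.+ ε

{-# OPTIONS --safe #-}

-- Fix an unoccupied site x and let φ be |y − x|⁻² with a suitable value at x; it is
-- subharmonic off x. Give each occupied site the charge (1 + j) φ(y) − φ(n₀) − … − φ(n_{j−1}),
-- where n_i are the neighbours in rotor order and ε_j is the current rotor: every step of a
-- particle then changes the sum of charges plus φ at the particle by a nonnegative amount,
-- because x is never left. As a charge is at most 4 φ(y), after m particles m |x|⁻² ≤ 4 Σ φ(y)
-- over the occupied sites, which is O(log² m) by the crude product bound φ(a, b) ≤ 3 / ((1 +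
-- |a|)(1 + |b|)) for relative coordinates. This keeps x outside a disc of radius of order √m /
-- log m, far larger than the disc of radius of order m^(1/4). The same charges built from |y|²
-- and a gain of 1 per step bound the number of steps of a particle, so every particle stops.

module Submission where

open import Defs
open import Data.Nat using (ℕ; _≥_)
open import Data.Nat as ℕ using (zero; suc)
import Data.Nat.Properties as ℕₚ
import Data.Nat.Tactic.RingSolver as ℕRing
open import Data.Integer as ℤ using (ℤ; +_; -[1+_])
import Data.Integer.Properties as ℤₚ
import Data.Integer.Tactic.RingSolver as ℤRing
open import Data.Rational using (ℚ; mkℚ; 0ℚ; 1ℚ; ½; _<_; _≤_; _+_; _*_; _-_; -_; _/_; toℚᵘ; nonNegative)
open import Data.Rational.Properties
open import Data.Rational.Unnormalised as ℚᵘ using (mkℚᵘ; *≡*; *≤*)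
import Data.Rational.Unnormalised.Properties as ℚᵘₚ
open import Data.Fin using (Fin; zero; suc; punchOut)
open import Data.Fin.Patterns using (0F; 1F; 2F; 3F)
open import Data.Fin.Permutation using (Permutation; permutation)
open import Data.Fin.Properties as Finₚ using (any?; punchOut-injective; injective⇒≤)
open import Data.Product using (Σ; ∃; _×_; _,_; proj₁; proj₂; map₂)
open import Data.Sum using (_⊎_; inj₁; inj₂)
open import Data.Empty using (⊥-elim)
open import Data.Maybe using (Maybe; just; nothing; maybe)
open import Algebra.Properties.CommutativeMonoid.Sum +-0-commutativeMonoid using (sum; sum-permute)
open import Function.Definitions using (Injective)
open import Level using (0ℓ)
open import Relation.Nullary using (¬_; yes; no)
open import Relation.Nullary.Decidable using (dec⇒maybe; toWitness)
open import Relation.Binary.PropositionalEquality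
  using (_≡_; _≢_; refl; sym; trans; cong; cong₂; subst; subst₂; module ≡-Reasoning)
open import Tactic.RingSolver using (solve-∀)
open import Tactic.RingSolver.Core.AlmostCommutativeRing using (AlmostCommutativeRing; fromCommutativeRing)

-- Rational arithmetic

ℚ-ring : AlmostCommutativeRing 0ℓ 0ℓ
ℚ-ring = fromCommutativeRing +-*-commutativeRing (λ q → dec⇒maybe (0ℚ ≟ q))

toℚᵘ-/ : ∀ n d → toℚᵘ (n / suc d) ℚᵘ.≃ mkℚᵘ n d
toℚᵘ-/ n d = toℚᵘ-fromℚᵘ (mkℚᵘ n d)

ℕ→ℚ-homo-+ : ∀ m n → ℕ→ℚ (m ℕ.+ n) ≡ ℕ→ℚ m + ℕ→ℚ n
ℕ→ℚ-homo-+ m n = toℚᵘ-injective (begin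
  toℚᵘ (ℕ→ℚ (m ℕ.+ n))               ≈⟨ toℚᵘ-/ (+ (m ℕ.+ n)) 0 ⟩
  mkℚᵘ (+ (m ℕ.+ n)) 0
    ≈⟨ *≡* (cong (ℤ._* + 1) (cong₂ ℤ._+_ (sym (ℤₚ.*-identityʳ (+ m))) (sym (ℤₚ.*-identityʳ (+ n))))) ⟩
  mkℚᵘ (+ m) 0 ℚᵘ.+ mkℚᵘ (+ n) 0     ≈⟨ ℚᵘₚ.+-cong (toℚᵘ-/ (+ m) 0) (toℚᵘ-/ (+ n) 0) ⟨
  toℚᵘ (ℕ→ℚ m) ℚᵘ.+ toℚᵘ (ℕ→ℚ n)     ≈⟨ toℚᵘ-homo-+ (ℕ→ℚ m) (ℕ→ℚ n) ⟨
  toℚᵘ (ℕ→ℚ m + ℕ→ℚ n)               ∎)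
  where open ℚᵘₚ.≃-Reasoning

ℕ→ℚ-homo-* : ∀ m n → ℕ→ℚ (m ℕ.* n) ≡ ℕ→ℚ m * ℕ→ℚ n
ℕ→ℚ-homo-* m n = toℚᵘ-injective (begin
  toℚᵘ (ℕ→ℚ (m ℕ.* n))               ≈⟨ toℚᵘ-/ (+ (m ℕ.* n)) 0 ⟩
  mkℚᵘ (+ (m ℕ.* n)) 0               ≈⟨ *≡* (cong (ℤ._* + 1) (ℤₚ.pos-* m n)) ⟩
  mkℚᵘ (+ m) 0 ℚᵘ.* mkℚᵘ (+ n) 0     ≈⟨ ℚᵘₚ.*-cong (toℚᵘ-/ (+ m) 0) (toℚᵘ-/ (+ n) 0) ⟨
  toℚᵘ (ℕ→ℚ m) ℚᵘ.* toℚᵘ (ℕ→ℚ n)     ≈⟨ toℚᵘ-homo-* (ℕ→ℚ m) (ℕ→ℚ n) ⟨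
  toℚᵘ (ℕ→ℚ m * ℕ→ℚ n)               ∎)
  where open ℚᵘₚ.≃-Reasoning

ℕ→ℚ-mono-≤ : ∀ {m n} → m ℕ.≤ n → ℕ→ℚ m ≤ ℕ→ℚ n
ℕ→ℚ-mono-≤ {m} {n} m≤n = toℚᵘ-cancel-≤
  (ℚᵘₚ.≤-respˡ-≃ (ℚᵘₚ.≃-sym (toℚᵘ-/ (+ m) 0))
  (ℚᵘₚ.≤-respʳ-≃ (ℚᵘₚ.≃-sym (toℚᵘ-/ (+ n) 0))
  (*≤* (ℤₚ.*-monoʳ-≤-nonNeg (+ 1) (ℤ.+≤+ m≤n)))))

ℕ→ℚ-cancel-≤ : ∀ {m n} → ℕ→ℚ m ≤ ℕ→ℚ n → m ℕ.≤ n
ℕ→ℚ-cancel-≤ {m} {n} le = ℤₚ.drop‿+≤+ (subst₂ ℤ._≤_ (ℤₚ.*-identityʳ (+ m)) (ℤₚ.*-identityʳ (+ n))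
  (ℚᵘₚ.drop-*≤* (ℚᵘₚ.≤-respˡ-≃ (toℚᵘ-/ (+ m) 0) (ℚᵘₚ.≤-respʳ-≃ (toℚᵘ-/ (+ n) 0) (toℚᵘ-mono-≤ le)))))

0≤ℕ→ℚ : ∀ n → 0ℚ ≤ ℕ→ℚ n
0≤ℕ→ℚ n = ℕ→ℚ-mono-≤ {0} {n} ℕ.z≤n

archimedean : ∀ q → ∃ λ n → q ≤ ℕ→ℚ n
archimedean q@(mkℚ n d _) = ℤ.∣ n ∣ , toℚᵘ-cancel-≤
  (ℚᵘₚ.≤-respʳ-≃ (ℚᵘₚ.≃-sym (toℚᵘ-/ (+ ℤ.∣ n ∣) 0))
  (*≤* (ℤₚ.≤-trans (ℤₚ.*-monoʳ-≤-nonNeg (+ 1) (n≤∣n∣ n))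
    (ℤₚ.*-monoˡ-≤-nonNeg (+ ℤ.∣ n ∣) (ℤ.+≤+ (ℕ.s≤s ℕ.z≤n))))))
  where
  n≤∣n∣ : ∀ i → i ℤ.≤ + ℤ.∣ i ∣
  n≤∣n∣ (+ _) = ℤₚ.≤-refl
  n≤∣n∣ -[1+ _ ] = ℤ.-≤+

recip : ℕ → ℚ
recip k = + 1 / suc k

recip-inverse : ∀ k → recip k * ℕ→ℚ (suc k) ≡ 1ℚ
recip-inverse k = toℚᵘ-injective (begin
  toℚᵘ (recip k * ℕ→ℚ (suc k))               ≈⟨ toℚᵘ-homo-* (recip k) (ℕ→ℚ (suc k)) ⟩
  toℚᵘ (recip k) ℚᵘ.* toℚᵘ (ℕ→ℚ (suc k))     ≈⟨ ℚᵘₚ.*-cong (toℚᵘ-/ (+ 1) k) (toℚᵘ-/ (+ suc k) 0) ⟩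
  mkℚᵘ (+ 1) k ℚᵘ.* mkℚᵘ (+ suc k) 0
    ≈⟨ *≡* (trans (ℤₚ.*-identityʳ (+ 1 ℤ.* + suc k)) (cong (λ j → + 1 ℤ.* + j) (sym (ℕₚ.*-identityʳ (suc k))))) ⟩
  toℚᵘ 1ℚ ∎)
  where open ℚᵘₚ.≃-Reasoning


0≤-+ : ∀ {p q} → 0ℚ ≤ p → 0ℚ ≤ q → 0ℚ ≤ p + q
0≤-+ = +-mono-≤

0≤-* : ∀ {p q} → 0ℚ ≤ p → 0ℚ ≤ q → 0ℚ ≤ p * q
0≤-* {p} {q} 0≤p 0≤q = subst (_≤ p * q) (*-zeroʳ p) (*-monoˡ-≤-nonNeg p {{nonNegative 0≤p}} 0≤q)

*-monoˡ-≤ : ∀ {p q} r → 0ℚ ≤ r → p ≤ q → r * p ≤ r * q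
*-monoˡ-≤ r 0≤r = *-monoˡ-≤-nonNeg r {{nonNegative 0≤r}}

*-mono-≤ : ∀ {p q r s} → 0ℚ ≤ p → 0ℚ ≤ r → p ≤ q → r ≤ s → p * r ≤ q * s
*-mono-≤ {p} {q} {r} {s} 0≤p 0≤r p≤q r≤s = ≤-trans
  (*-monoˡ-≤-nonNeg p {{nonNegative 0≤p}} r≤s)
  (*-monoʳ-≤-nonNeg s {{nonNegative (≤-trans 0≤r r≤s)}} p≤q)

p≤p+q : ∀ p {q} → 0ℚ ≤ q → p ≤ p + q
p≤p+q p {q} 0≤q = subst (_≤ p + q) (+-identityʳ p) (+-monoʳ-≤ p 0≤q)

p≤q⇒0≤q-p : ∀ {p q} → p ≤ q → 0ℚ ≤ q - p
p≤q⇒0≤q-p {p} {q} p≤q = subst (_≤ q - p) (+-inverseʳ p) (+-monoˡ-≤ (- p) p≤q)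

0≤-² : ∀ p → 0ℚ ≤ p * p
0≤-² p with ≤-total 0ℚ p
... | inj₁ 0≤p = 0≤-* 0≤p 0≤p
... | inj₂ p≤0 = subst (0ℚ ≤_) (neg-square p) (0≤-* 0≤-p 0≤-p)
  where
  0≤-p = neg-antimono-≤ p≤0
  neg-square : ∀ p → (- p) * (- p) ≡ p * p
  neg-square = solve-∀ ℚ-ring

0≤recip : ∀ k → 0ℚ ≤ recip k
0≤recip k = nonNegative⁻¹ (recip k) {{normalize-nonNeg 1 (suc k)}}

-- With `p = 1/a` and `q = 1/b` the right side is `(a + b) / t` for `t = a * b`. For every `c` the
-- tangent of `1/t` at `t = 1/c` gives `1/t ≥ 2c - c² t`, with gap `(1 - c t)² / t`.
reciprocal-pair : ∀ {p q a b} c → p * a ≡ 1ℚ → q * b ≡ 1ℚ → 0ℚ ≤ p → 0ℚ ≤ q → 0ℚ ≤ a + b →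
  (a + b) * (c + c - c * c * (a * b)) ≤ p + q
reciprocal-pair {p} {q} {a} {b} c pa≡1 qb≡1 0≤p 0≤q 0≤a+b = begin
  (a + b) * (c + c - c * c * (a * b))                ≡⟨ units a b c ⟩
  f 1ℚ 1ℚ                                            ≡⟨ cong₂ f pa≡1 qb≡1 ⟨
  f (p * a) (q * b)
    ≤⟨ p≤p+q _ (0≤-* (0≤-* 0≤a+b (0≤-* 0≤p 0≤q)) (0≤-² (1ℚ - c * (a * b)))) ⟩
  f (p * a) (q * b) + (a + b) * (p * q) * (d * d)    ≡⟨ identity p q a b c ⟩
  p * (q * b) + q * (p * a)                          ≡⟨ cong₂ (λ u v → p * u + q * v) qb≡1 pa≡1 ⟩
  p * 1ℚ + q * 1ℚ                                    ≡⟨ cong₂ _+_ (*-identityʳ p) (*-identityʳ q) ⟩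
  p + q                                              ∎
  where
  open ≤-Reasoning
  d = 1ℚ - c * (a * b)
  -- The ring solver cannot use `p * a ≡ 1ℚ`, so the units that make `identity` homogeneous are kept
  -- as arguments: first 1, then `p * a` and `q * b`.
  f : ℚ → ℚ → ℚ
  f u v = (a + b) * (c * u * v + c * u * v - c * c * (a * b) * u * v)
  units : ∀ a b c → (a + b) * (c + c - c * c * (a * b)) ≡
    (a + b) * (c * 1ℚ * 1ℚ + c * 1ℚ * 1ℚ - c * c * (a * b) * 1ℚ * 1ℚ)
  units = solve-∀ ℚ-ring
  identity : ∀ p q a b c →
    (a + b) * (c * (p * a) * (q * b) + c * (p * a) * (q * b) - c * c * (a * b) * (p * a) * (q * b))
      + (a + b) * (p * q) * ((1ℚ - c * (a * b)) * (1ℚ - c * (a * b)))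
    ≡ p * (q * b) + q * (p * a)
  identity = solve-∀ ℚ-ring

-- Here `s` stands for the squared norm of a site and the `t`s for those of its neighbours, in
-- opposite pairs. Both pairs have the same sum and their products average to `1 + s²`, so
-- `reciprocal-pair` is applied with `c = 1/s²`. What remains above `4r` is `4r² (1 - r - r²)`,
-- which is nonnegative for `r ≤ ½`.
reciprocal-four : ∀ {r s p₁ p₂ p₃ p₄ t₁ t₂ t₃ t₄} → 0ℚ ≤ r → r ≤ ½ → 0ℚ ≤ s → r * s ≡ 1ℚ →
  p₁ * t₁ ≡ 1ℚ → p₂ * t₂ ≡ 1ℚ → p₃ * t₃ ≡ 1ℚ → p₄ * t₄ ≡ 1ℚ →
  0ℚ ≤ p₁ → 0ℚ ≤ p₂ → 0ℚ ≤ p₃ → 0ℚ ≤ p₄ →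
  t₁ + t₂ ≡ ℕ→ℚ 2 * (1ℚ + s) → t₃ + t₄ ≡ ℕ→ℚ 2 * (1ℚ + s) →
  t₁ * t₂ + t₃ * t₄ ≡ ℕ→ℚ 2 * (1ℚ + s * s) →
  ℕ→ℚ 4 * r ≤ (p₁ + p₂) + (p₃ + p₄)
reciprocal-four {r} {s} {p₁} {p₂} {p₃} {p₄} {t₁} {t₂} {t₃} {t₄}
  0≤r r≤½ 0≤s rs≡1 e₁ e₂ e₃ e₄ 0≤p₁ 0≤p₂ 0≤p₃ 0≤p₄ sum₁₂ sum₃₄ products = begin
  ℕ→ℚ 4 * r                                    ≤⟨ p≤p+q _ (0≤-* (0≤-* (0≤ℕ→ℚ 4) (0≤-² r)) 0≤gap) ⟩
  ℕ→ℚ 4 * r + ℕ→ℚ 4 * (r * r) * ((½ - r) * (ℕ→ℚ 2 - ½ + r) + ½ * ½)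
                                               ≡⟨ factor r ⟩
  g 1ℚ                                         ≡⟨ cong g rs≡1 ⟨
  g (r * s)                                    ≡⟨ expand r s ⟩
  T * (ℕ→ℚ 4 * c - c * c * (ℕ→ℚ 2 * (1ℚ + s * s)))
                                               ≡⟨ cong (λ P → T * (ℕ→ℚ 4 * c - c * c * P)) products ⟨
  T * (ℕ→ℚ 4 * c - c * c * (t₁ * t₂ + t₃ * t₄)) ≡⟨ split T c (t₁ * t₂) (t₃ * t₄) ⟩
  T * (c + c - c * c * (t₁ * t₂)) + T * (c + c - c * c * (t₃ * t₄))
                                               ≡⟨ cong₂ (λ U V → U * (c + c - c * c * (t₁ * t₂)) + V * (c + c - c * c * (t₃ * t₄))) sum₁₂ sum₃₄ ⟨
  (t₁ + t₂) * (c + c - c * c * (t₁ * t₂)) + (t₃ + t₄) * (c + c - c * c * (t₃ * t₄))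
                                               ≤⟨ +-mono-≤ (reciprocal-pair c e₁ e₂ 0≤p₁ 0≤p₂ (subst (0ℚ ≤_) (sym sum₁₂) 0≤T))
                                                           (reciprocal-pair c e₃ e₄ 0≤p₃ 0≤p₄ (subst (0ℚ ≤_) (sym sum₃₄) 0≤T)) ⟩
  (p₁ + p₂) + (p₃ + p₄) ∎
  where
  open ≤-Reasoning
  c = r * r
  T = ℕ→ℚ 2 * (1ℚ + s)
  0≤T : 0ℚ ≤ T
  0≤T = 0≤-* (0≤ℕ→ℚ 2) (0≤-+ (0≤ℕ→ℚ 1) 0≤s)
  -- This is `1 - r - r²`, arranged so that `r ≤ ½` makes each summand visibly nonnegative.
  0≤gap : 0ℚ ≤ (½ - r) * (ℕ→ℚ 2 - ½ + r) + ½ * ½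
  0≤gap = 0≤-+ (0≤-* (p≤q⇒0≤q-p r≤½) (0≤-+ (toWitness {a? = 0ℚ ≤? (ℕ→ℚ 2 - ½)} _) 0≤r)) (toWitness {a? = 0ℚ ≤? (½ * ½)} _)
  g : ℚ → ℚ
  g u = ℕ→ℚ 8 * (u * r) + ℕ→ℚ 8 * (r * r) - ℕ→ℚ 4 * (u * u * u * r) - ℕ→ℚ 4 * (u * u * (r * r))
        - ℕ→ℚ 4 * (u * (r * r * r)) - ℕ→ℚ 4 * (r * r * (r * r))
  factor : ∀ r → ℕ→ℚ 4 * r + ℕ→ℚ 4 * (r * r) * ((½ - r) * (ℕ→ℚ 2 - ½ + r) + ½ * ½) ≡
    ℕ→ℚ 8 * (1ℚ * r) + ℕ→ℚ 8 * (r * r) - ℕ→ℚ 4 * (1ℚ * 1ℚ * 1ℚ * r) - ℕ→ℚ 4 * (1ℚ * 1ℚ * (r * r))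
        - ℕ→ℚ 4 * (1ℚ * (r * r * r)) - ℕ→ℚ 4 * (r * r * (r * r))
  factor = solve-∀ ℚ-ring
  expand : ∀ r s →
    ℕ→ℚ 8 * (r * s * r) + ℕ→ℚ 8 * (r * r) - ℕ→ℚ 4 * (r * s * (r * s) * (r * s) * r)
        - ℕ→ℚ 4 * (r * s * (r * s) * (r * r))
        - ℕ→ℚ 4 * (r * s * (r * r * r)) - ℕ→ℚ 4 * (r * r * (r * r)) ≡
    ℕ→ℚ 2 * (1ℚ + s) * (ℕ→ℚ 4 * (r * r) - (r * r) * (r * r) * (ℕ→ℚ 2 * (1ℚ + s * s)))
  expand = solve-∀ ℚ-ring
  split : ∀ T c P Q → T * (ℕ→ℚ 4 * c - c * c * (P + Q)) ≡ T * (c + c - c * c * P) + T * (c + c - c * c * Q)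
  split = solve-∀ ℚ-ring

-- The subharmonic function |z|⁻²

norm : Site → ℕ
norm (a , b) = ℤ.∣ a ∣ ℕ.* ℤ.∣ a ∣ ℕ.+ ℤ.∣ b ∣ ℕ.* ℤ.∣ b ∣

+norm : ∀ a b → + norm (a , b) ≡ a ℤ.* a ℤ.+ b ℤ.* b
+norm a b = cong₂ ℤ._+_ (square a) (square b)
  where
  square : ∀ a → + (ℤ.∣ a ∣ ℕ.* ℤ.∣ a ∣) ≡ a ℤ.* a
  square (+ n) = ℤₚ.pos-* n n
  square -[1+ n ] = refl

norm-sum₁ : ∀ z → norm (z ⊕ vec +e₁) ℕ.+ norm (z ⊕ vec -e₁) ≡ 2 ℕ.* (1 ℕ.+ norm z)
norm-sum₁ (a , b) = ℤₚ.+-injective (begin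
  + norm (a ℤ.+ + 1 , b ℤ.+ + 0) ℤ.+ + norm (a ℤ.+ ℤ.- + 1 , b ℤ.+ + 0)
    ≡⟨ cong₂ ℤ._+_ (+norm (a ℤ.+ + 1) (b ℤ.+ + 0)) (+norm (a ℤ.+ ℤ.- + 1) (b ℤ.+ + 0)) ⟩
  _ ≡⟨ identity a b ⟩
  + 2 ℤ.* (+ 1 ℤ.+ (a ℤ.* a ℤ.+ b ℤ.* b)) ≡⟨ cong (λ i → + 2 ℤ.* (+ 1 ℤ.+ i)) (+norm a b) ⟨
  + 2 ℤ.* + (1 ℕ.+ norm (a , b))  ≡⟨ ℤₚ.pos-* 2 (1 ℕ.+ norm (a , b)) ⟨
  + (2 ℕ.* (1 ℕ.+ norm (a , b))) ∎)
  where
  open ≡-Reasoning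
  identity : ∀ a b →
    ((a ℤ.+ + 1) ℤ.* (a ℤ.+ + 1) ℤ.+ (b ℤ.+ + 0) ℤ.* (b ℤ.+ + 0)) ℤ.+
    ((a ℤ.+ ℤ.- + 1) ℤ.* (a ℤ.+ ℤ.- + 1) ℤ.+ (b ℤ.+ + 0) ℤ.* (b ℤ.+ + 0))
    ≡ + 2 ℤ.* (+ 1 ℤ.+ (a ℤ.* a ℤ.+ b ℤ.* b))
  identity = ℤRing.solve-∀

norm-swap : ∀ a b → norm (a , b) ≡ norm (b , a)
norm-swap a b = ℕₚ.+-comm (ℤ.∣ a ∣ ℕ.* ℤ.∣ a ∣) (ℤ.∣ b ∣ ℕ.* ℤ.∣ b ∣)

norm-sum₂ : ∀ z → norm (z ⊕ vec +e₂) ℕ.+ norm (z ⊕ vec -e₂) ≡ 2 ℕ.* (1 ℕ.+ norm z)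
norm-sum₂ (a , b) = begin
  norm (a ℤ.+ + 0 , b ℤ.+ + 1) ℕ.+ norm (a ℤ.+ + 0 , b ℤ.+ ℤ.- + 1)
    ≡⟨ cong₂ ℕ._+_ (norm-swap (a ℤ.+ + 0) (b ℤ.+ + 1)) (norm-swap (a ℤ.+ + 0) (b ℤ.+ ℤ.- + 1)) ⟩
  norm (b ℤ.+ + 1 , a ℤ.+ + 0) ℕ.+ norm (b ℤ.+ ℤ.- + 1 , a ℤ.+ + 0)
    ≡⟨ norm-sum₁ (b , a) ⟩
  2 ℕ.* (1 ℕ.+ norm (b , a)) ≡⟨ cong (λ i → 2 ℕ.* (1 ℕ.+ i)) (norm-swap b a) ⟩
  2 ℕ.* (1 ℕ.+ norm (a , b)) ∎
  where open ≡-Reasoning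

-- With `s = a² + b²` the two products are `(1 + s)² - 4a²` and `(1 + s)² - 4b²`, so their sum
-- depends on `s` alone.
norm-products : ∀ z → norm (z ⊕ vec +e₁) ℕ.* norm (z ⊕ vec -e₁) ℕ.+ norm (z ⊕ vec +e₂) ℕ.* norm (z ⊕ vec -e₂)
  ≡ 2 ℕ.* (1 ℕ.+ norm z ℕ.* norm z)
norm-products (a , b) = ℤₚ.+-injective (begin
  + (n₁ ℕ.* n₂) ℤ.+ + (n₃ ℕ.* n₄)
    ≡⟨ cong₂ ℤ._+_ (ℤₚ.pos-* n₁ n₂) (ℤₚ.pos-* n₃ n₄) ⟩
  + n₁ ℤ.* + n₂ ℤ.+ + n₃ ℤ.* + n₄
    ≡⟨ cong₂ ℤ._+_ (cong₂ ℤ._*_ (+norm (a ℤ.+ + 1) (b ℤ.+ + 0)) (+norm (a ℤ.+ ℤ.- + 1) (b ℤ.+ + 0)))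
                   (cong₂ ℤ._*_ (+norm (a ℤ.+ + 0) (b ℤ.+ + 1)) (+norm (a ℤ.+ + 0) (b ℤ.+ ℤ.- + 1))) ⟩
  _ ≡⟨ identity a b ⟩
  + 2 ℤ.* (+ 1 ℤ.+ (a ℤ.* a ℤ.+ b ℤ.* b) ℤ.* (a ℤ.* a ℤ.+ b ℤ.* b))
    ≡⟨ cong (λ i → + 2 ℤ.* (+ 1 ℤ.+ i ℤ.* i)) (+norm a b) ⟨
  + 2 ℤ.* (+ 1 ℤ.+ + s ℤ.* + s)  ≡⟨ cong (λ i → + 2 ℤ.* (+ 1 ℤ.+ i)) (ℤₚ.pos-* s s) ⟨
  + 2 ℤ.* + (1 ℕ.+ s ℕ.* s)      ≡⟨ ℤₚ.pos-* 2 (1 ℕ.+ s ℕ.* s) ⟨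
  + (2 ℕ.* (1 ℕ.+ s ℕ.* s)) ∎)
  where
  open ≡-Reasoning
  s = norm (a , b)
  n₁ = norm (a ℤ.+ + 1 , b ℤ.+ + 0)
  n₂ = norm (a ℤ.+ ℤ.- + 1 , b ℤ.+ + 0)
  n₃ = norm (a ℤ.+ + 0 , b ℤ.+ + 1)
  n₄ = norm (a ℤ.+ + 0 , b ℤ.+ ℤ.- + 1)
  identity : ∀ a b →
    ((a ℤ.+ + 1) ℤ.* (a ℤ.+ + 1) ℤ.+ (b ℤ.+ + 0) ℤ.* (b ℤ.+ + 0)) ℤ.*
    ((a ℤ.+ ℤ.- + 1) ℤ.* (a ℤ.+ ℤ.- + 1) ℤ.+ (b ℤ.+ + 0) ℤ.* (b ℤ.+ + 0)) ℤ.+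
    ((a ℤ.+ + 0) ℤ.* (a ℤ.+ + 0) ℤ.+ (b ℤ.+ + 1) ℤ.* (b ℤ.+ + 1)) ℤ.*
    ((a ℤ.+ + 0) ℤ.* (a ℤ.+ + 0) ℤ.+ (b ℤ.+ ℤ.- + 1) ℤ.* (b ℤ.+ ℤ.- + 1))
    ≡ + 2 ℤ.* (+ 1 ℤ.+ (a ℤ.* a ℤ.+ b ℤ.* b) ℤ.* (a ℤ.* a ℤ.+ b ℤ.* b))
  identity = ℤRing.solve-∀

norm≡0⇒≡origin : ∀ z → norm z ≡ 0 → z ≡ origin
norm≡0⇒≡origin (+ zero , + zero) _ = refl
norm≡0⇒≡origin (+ zero , + suc _) ()
norm≡0⇒≡origin (+ zero , -[1+ _ ]) ()
norm≡0⇒≡origin (+ suc _ , _) ()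
norm≡0⇒≡origin (-[1+ _ ] , _) ()

vec-norm : ∀ d → norm (vec d) ≡ 1
vec-norm +e₁ = refl
vec-norm -e₁ = refl
vec-norm +e₂ = refl
vec-norm -e₂ = refl

-- The hypothesis says `z = -u`. For a unit vector `u` it follows that only sites of norm 1 have the
-- pole as a neighbour.
norm-opposite : ∀ z u → norm (z ⊕ u) ≡ 0 → norm z ≡ norm u
norm-opposite (a , b) (c , d) eq with norm≡0⇒≡origin ((a , b) ⊕ (c , d)) eq
... | z⊕u≡0 = cong₂ (λ m n → m ℕ.* m ℕ.+ n ℕ.* n)
  (opposite a c (cong proj₁ z⊕u≡0)) (opposite b d (cong proj₂ z⊕u≡0))
  where
  opposite : ∀ i j → i ℤ.+ j ≡ + 0 → ℤ.∣ i ∣ ≡ ℤ.∣ j ∣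
  opposite i j i+j≡0 = trans (cong ℤ.∣_∣ (ℤₚ.i-j≡0⇒i≡j i (ℤ.- j) (trans (cong (λ k → i ℤ.+ k) (ℤₚ.neg-involutive j)) i+j≡0))) (ℤₚ.∣-i∣≡∣i∣ j)

-- The value at the pole only has to make φ subharmonic at its four neighbours.
reciprocalOrPole : ℕ → ℚ
reciprocalOrPole zero = ℕ→ℚ 3
reciprocalOrPole (suc k) = recip k

φ : Site → ℚ
φ z = reciprocalOrPole (norm z)

0≤φ : ∀ z → 0ℚ ≤ φ z
0≤φ z with norm z
... | zero = 0≤ℕ→ℚ 3
... | suc k = 0≤recip k

neighbourSum : (Site → ℚ) → Site → ℚ
neighbourSum f z = (f (z ⊕ vec +e₁) + f (z ⊕ vec -e₁)) + (f (z ⊕ vec +e₂) + f (z ⊕ vec -e₂))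

-- The neighbours are the pole, with value 3, and three sites with values 1/4, 1/2 and 1/2: together
-- 17/4, against 4 on the left.
φ-subharmonic-unit : ∀ z → norm z ≡ 1 → ℕ→ℚ 4 * φ z ≤ neighbourSum φ z
φ-subharmonic-unit (+ 0 , + 0) ()
φ-subharmonic-unit (+ 0 , + 1) _ = toWitness {a? = _ ≤? _} _
φ-subharmonic-unit (+ 0 , -[1+ 0 ]) _ = toWitness {a? = _ ≤? _} _
φ-subharmonic-unit (+ 0 , + suc (suc _)) ()
φ-subharmonic-unit (+ 0 , -[1+ suc _ ]) ()
φ-subharmonic-unit (+ 1 , + 0) _ = toWitness {a? = _ ≤? _} _
φ-subharmonic-unit (+ 1 , + suc _) ()
φ-subharmonic-unit (+ 1 , -[1+ _ ]) ()
φ-subharmonic-unit (+ suc (suc _) , _) ()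
φ-subharmonic-unit (-[1+ 0 ] , + 0) _ = toWitness {a? = _ ≤? _} _
φ-subharmonic-unit (-[1+ 0 ] , + suc _) ()
φ-subharmonic-unit (-[1+ 0 ] , -[1+ _ ]) ()
φ-subharmonic-unit (-[1+ suc _ ] , _) ()

reciprocalOrPole-inverse : ∀ n → n ≢ 0 → reciprocalOrPole n * ℕ→ℚ n ≡ 1ℚ
reciprocalOrPole-inverse zero n≢0 = ⊥-elim (n≢0 refl)
reciprocalOrPole-inverse (suc k) _ = recip-inverse k

cast-sum : ∀ m n s → m ℕ.+ n ≡ 2 ℕ.* (1 ℕ.+ s) → ℕ→ℚ m + ℕ→ℚ n ≡ ℕ→ℚ 2 * (1ℚ + ℕ→ℚ s)
cast-sum m n s eq = begin
  ℕ→ℚ m + ℕ→ℚ n             ≡⟨ ℕ→ℚ-homo-+ m n ⟨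
  ℕ→ℚ (m ℕ.+ n)             ≡⟨ cong ℕ→ℚ eq ⟩
  ℕ→ℚ (2 ℕ.* (1 ℕ.+ s))     ≡⟨ ℕ→ℚ-homo-* 2 (1 ℕ.+ s) ⟩
  ℕ→ℚ 2 * ℕ→ℚ (1 ℕ.+ s)     ≡⟨ cong (ℕ→ℚ 2 *_) (ℕ→ℚ-homo-+ 1 s) ⟩
  ℕ→ℚ 2 * (1ℚ + ℕ→ℚ s)      ∎
  where open ≡-Reasoning

φ-subharmonic-far : ∀ z → 2 ℕ.≤ norm z → ℕ→ℚ 4 * φ z ≤ neighbourSum φ z
φ-subharmonic-far z 2≤s = reciprocal-four {r = φ z} {s = ℕ→ℚ s}
  {t₁ = ℕ→ℚ (t +e₁)} {t₂ = ℕ→ℚ (t -e₁)} {t₃ = ℕ→ℚ (t +e₂)} {t₄ = ℕ→ℚ (t -e₂)}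
  (0≤φ z) r≤½ (0≤ℕ→ℚ s) rs≡1 (inv +e₁) (inv -e₁) (inv +e₂) (inv -e₂)
  (0≤φ (z ⊕ vec +e₁)) (0≤φ (z ⊕ vec -e₁)) (0≤φ (z ⊕ vec +e₂)) (0≤φ (z ⊕ vec -e₂))
  (cast-sum (t +e₁) (t -e₁) s (norm-sum₁ z)) (cast-sum (t +e₂) (t -e₂) s (norm-sum₂ z))
  (begin
    ℕ→ℚ (t +e₁) * ℕ→ℚ (t -e₁) + ℕ→ℚ (t +e₂) * ℕ→ℚ (t -e₂)
      ≡⟨ cong₂ _+_ (ℕ→ℚ-homo-* (t +e₁) (t -e₁)) (ℕ→ℚ-homo-* (t +e₂) (t -e₂)) ⟨
    ℕ→ℚ (t +e₁ ℕ.* t -e₁) + ℕ→ℚ (t +e₂ ℕ.* t -e₂)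
      ≡⟨ cast-sum (t +e₁ ℕ.* t -e₁) (t +e₂ ℕ.* t -e₂) (s ℕ.* s) (norm-products z) ⟩
    ℕ→ℚ 2 * (1ℚ + ℕ→ℚ (s ℕ.* s))
      ≡⟨ cong (λ q → ℕ→ℚ 2 * (1ℚ + q)) (ℕ→ℚ-homo-* s s) ⟩
    ℕ→ℚ 2 * (1ℚ + ℕ→ℚ s * ℕ→ℚ s) ∎)
  where
  open ≡-Reasoning
  s = norm z
  t : Dir → ℕ
  t d = norm (z ⊕ vec d)
  s≢0 : s ≢ 0
  s≢0 s≡0 = ℕₚ.<⇒≱ 2≤s (ℕₚ.≤-trans (ℕₚ.≤-reflexive s≡0) ℕ.z≤n)
  t≢0 : ∀ d → t d ≢ 0
  t≢0 d t≡0 = ℕₚ.<⇒≢ 2≤s (sym (trans (norm-opposite z (vec d) t≡0) (vec-norm d)))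
  inv : ∀ d → φ (z ⊕ vec d) * ℕ→ℚ (t d) ≡ 1ℚ
  inv d = reciprocalOrPole-inverse (t d) (t≢0 d)
  rs≡1 : φ z * ℕ→ℚ s ≡ 1ℚ
  rs≡1 = reciprocalOrPole-inverse s s≢0
  r≤½ : φ z ≤ ½
  r≤½ = *-cancelˡ-≤-pos (ℕ→ℚ 2) (subst₂ _≤_ (*-comm (φ z) (ℕ→ℚ 2)) rs≡1
    (*-monoˡ-≤ (φ z) (0≤φ z) (ℕ→ℚ-mono-≤ 2≤s)))

φ-subharmonic : ∀ z → z ≢ origin → ℕ→ℚ 4 * φ z ≤ neighbourSum φ z
φ-subharmonic z z≢0 = helper (norm z) refl
  where
  helper : ∀ s → norm z ≡ s → ℕ→ℚ 4 * φ z ≤ neighbourSum φ z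
  helper 0 eq = ⊥-elim (z≢0 (norm≡0⇒≡origin z eq))
  helper 1 eq = φ-subharmonic-unit z eq
  helper (suc (suc s)) eq = φ-subharmonic-far z (subst (2 ℕ.≤_) (sym eq) (ℕ.s≤s (ℕ.s≤s ℕ.z≤n)))

-- Sums over boxes

sumBelow : ℕ → (ℕ → ℚ) → ℚ
sumBelow zero f = 0ℚ
sumBelow (suc n) f = sumBelow n f + f n

sumBelow-mono : ∀ n {f g} → (∀ i → i ℕ.< n → f i ≤ g i) → sumBelow n f ≤ sumBelow n g
sumBelow-mono zero f≤g = ≤-refl
sumBelow-mono (suc n) f≤g =
  +-mono-≤ (sumBelow-mono n λ i i<n → f≤g i (ℕₚ.m<n⇒m<1+n i<n)) (f≤g n ℕₚ.≤-refl)

private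

  +-swapʳ : ∀ p q r → (p + q) + r ≡ (p + r) + q
  +-swapʳ = solve-∀ ℚ-ring

-- The form in which a change at one site passes to a whole sum: the exchange with the particle is
-- recorded by `c` and `d`, one on each side, so that nothing is subtracted.
sumBelow-replace : ∀ n {k f g c d} → k ℕ.< n → (∀ i → i ≢ k → f i ≤ g i) →
  f k + c ≤ g k + d → sumBelow n f + c ≤ sumBelow n g + d
sumBelow-replace (suc n) {k} {f} {g} {c} {d} k<1+n f≤g at-k with k ℕₚ.≟ n
... | yes refl = subst₂ _≤_ (sym (+-assoc (sumBelow n f) (f n) c)) (sym (+-assoc (sumBelow n g) (g n) d))
  (+-mono-≤ (sumBelow-mono n λ i i<n → f≤g i (ℕₚ.<⇒≢ i<n)) at-k)
... | no k≢n = subst₂ _≤_ (+-swapʳ (sumBelow n f) c (f n)) (+-swapʳ (sumBelow n g) d (g n))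
  (+-mono-≤ (sumBelow-replace n (ℕₚ.≤∧≢⇒< (ℕ.s≤s⁻¹ k<1+n) k≢n) f≤g at-k) (f≤g n (λ n≡k → k≢n (sym n≡k))))

sumBelow-* : ∀ n r f → sumBelow n (λ i → r * f i) ≡ r * sumBelow n f
sumBelow-* zero r f = sym (*-zeroʳ r)
sumBelow-* (suc n) r f = trans (cong (_+ r * f n) (sumBelow-* n r f)) (sym (*-distribˡ-+ r (sumBelow n f) (f n)))

sumBelow-0≤ : ∀ n {f} → (∀ i → 0ℚ ≤ f i) → 0ℚ ≤ sumBelow n f
sumBelow-0≤ zero 0≤f = ≤-refl
sumBelow-0≤ (suc n) 0≤f = +-mono-≤ (sumBelow-0≤ n 0≤f) (0≤f n)

sumBelow-+ : ∀ m n f → sumBelow (m ℕ.+ n) f ≡ sumBelow n f + sumBelow m (λ i → f (i ℕ.+ n))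
sumBelow-+ zero n f = sym (+-identityʳ (sumBelow n f))
sumBelow-+ (suc m) n f = trans (cong (_+ f (m ℕ.+ n)) (sumBelow-+ m n f))
  (+-assoc (sumBelow n f) (sumBelow m (λ i → f (i ℕ.+ n))) (f (m ℕ.+ n)))

sumBelow-const : ∀ n c → sumBelow n (λ _ → c) ≡ ℕ→ℚ n * c
sumBelow-const zero c = sym (*-zeroˡ c)
sumBelow-const (suc n) c = begin
  sumBelow n (λ _ → c) + c  ≡⟨ cong (_+ c) (sumBelow-const n c) ⟩
  ℕ→ℚ n * c + c             ≡⟨ distrib (ℕ→ℚ n) c ⟩
  (1ℚ + ℕ→ℚ n) * c          ≡⟨ cong (_* c) (ℕ→ℚ-homo-+ 1 n) ⟨
  ℕ→ℚ (suc n) * c           ∎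
  where
  open ≡-Reasoning
  distrib : ∀ p c → p * c + c ≡ (1ℚ + p) * c
  distrib = solve-∀ ℚ-ring

-- The window of size N is the integer interval [-N, N-1].
index : ℤ → ℕ
index (+ n) = n
index -[1+ n ] = n

sumWindow : ℕ → (ℤ → ℚ) → ℚ
sumWindow N f = sumBelow N (λ i → f (+ i) + f -[1+ i ])

sumWindow-mono : ∀ N {f g} → (∀ i → f i ≤ g i) → sumWindow N f ≤ sumWindow N g
sumWindow-mono N f≤g = sumBelow-mono N (λ i _ → +-mono-≤ (f≤g (+ i)) (f≤g -[1+ i ]))

sumWindow-* : ∀ N r f → sumWindow N (λ i → r * f i) ≡ r * sumWindow N f
sumWindow-* N r f = trans
  (sumBelow-cong N (λ i → sym (*-distribˡ-+ r (f (+ i)) (f -[1+ i ]))))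
  (sumBelow-* N r (λ i → f (+ i) + f -[1+ i ]))
  where
  sumBelow-cong : ∀ n {f g} → (∀ i → f i ≡ g i) → sumBelow n f ≡ sumBelow n g
  sumBelow-cong zero f≡g = refl
  sumBelow-cong (suc n) f≡g = cong₂ _+_ (sumBelow-cong n f≡g) (f≡g n)

sumWindow-replace : ∀ N {k f g c d} → index k ℕ.< N → (∀ i → i ≢ k → f i ≤ g i) →
  f k + c ≤ g k + d → sumWindow N f + c ≤ sumWindow N g + d
sumWindow-replace N {+ k} {f} {g} {c} {d} k<N f≤g at-k = sumBelow-replace N k<N
  (λ i i≢k → +-mono-≤ (f≤g (+ i) (λ eq → i≢k (ℤₚ.+-injective eq))) (f≤g -[1+ i ] (λ ())))
  (subst₂ _≤_ (+-swapʳ (f (+ k)) c (f -[1+ k ])) (+-swapʳ (g (+ k)) d (g -[1+ k ]))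
    (+-mono-≤ at-k (f≤g -[1+ k ] (λ ()))))
sumWindow-replace N { -[1+ k ] } {f} {g} {c} {d} k<N f≤g at-k = sumBelow-replace N k<N
  (λ i i≢k → +-mono-≤ (f≤g (+ i) (λ ())) (f≤g -[1+ i ] (λ eq → i≢k (ℤₚ.-[1+-injective eq))))
  (subst₂ _≤_ (sym (+-assoc (f (+ k)) (f -[1+ k ]) c)) (sym (+-assoc (g (+ k)) (g -[1+ k ]) d))
    (+-mono-≤ (f≤g (+ k) (λ ())) at-k))

_⊖_ : Site → Site → Site
(a , b) ⊖ (c , d) = (a ℤ.- c , b ℤ.- d)

sumBox : Site → ℕ → (Site → ℚ) → ℚ
sumBox x N f = sumWindow N λ a → sumWindow N λ b → f (x ⊕ (a , b))

InBox : Site → ℕ → Site → Set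
InBox x N y = index (proj₁ (y ⊖ x)) ℕ.< N × index (proj₂ (y ⊖ x)) ℕ.< N

i+[j-i]≡j : ∀ i j → i ℤ.+ (j ℤ.- i) ≡ j
i+[j-i]≡j = ℤRing.solve-∀

[i+j]-i≡j : ∀ i j → (i ℤ.+ j) ℤ.- i ≡ j
[i+j]-i≡j = ℤRing.solve-∀

sumBox-mono : ∀ x N {f g} → (∀ y → f y ≤ g y) → sumBox x N f ≤ sumBox x N g
sumBox-mono x N f≤g = sumWindow-mono N (λ a → sumWindow-mono N (λ b → f≤g (x ⊕ (a , b))))

sumBox-replace : ∀ x N {y f g c d} → InBox x N y → (∀ z → z ≢ y → f z ≤ g z) →
  f y + c ≤ g y + d → sumBox x N f + c ≤ sumBox x N g + d
sumBox-replace x@(x₁ , x₂) N {y₁ , y₂} {f} {g} {c} {d} (in₁ , in₂) f≤g at-y =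
  sumWindow-replace N in₁
    (λ a a≢ → sumWindow-mono N (λ b → f≤g (x ⊕ (a , b)) (λ eq → a≢ (displacement x₁ a (cong proj₁ eq)))))
    (sumWindow-replace N in₂
      (λ b b≢ → f≤g (x ⊕ (y₁ ℤ.- x₁ , b)) (λ eq → b≢ (displacement x₂ b (cong proj₂ eq))))
      (subst (λ y → f y + c ≤ g y + d)
        (sym (cong₂ _,_ (i+[j-i]≡j x₁ y₁) (i+[j-i]≡j x₂ y₂))) at-y))
  where
  displacement : ∀ i j {k} → i ℤ.+ j ≡ k → j ≡ k ℤ.- i
  displacement i j refl = sym ([i+j]-i≡j i j)

sumBox-0≤ : ∀ x N {f} → (∀ y → 0ℚ ≤ f y) → 0ℚ ≤ sumBox x N f
sumBox-0≤ x N 0≤f = sumWindow-0≤ (λ a → sumWindow-0≤ (λ b → 0≤f (x ⊕ (a , b))))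
  where
  sumWindow-0≤ : ∀ {f} → (∀ i → 0ℚ ≤ f i) → 0ℚ ≤ sumWindow N f
  sumWindow-0≤ 0≤f = sumBelow-0≤ N (λ i → 0≤-+ (0≤f (+ i)) (0≤f -[1+ i ]))

-- Rotors and charges

-- Pigeonhole: if `j` were missed, punching it out of the codomain would inject `Fin (suc n)` into
-- `Fin n`.
injective⇒preimage : ∀ {n} {f : Fin n → Fin n} → Injective _≡_ _≡_ f → ∀ j → ∃ λ i → f i ≡ j
injective⇒preimage {suc n} {f} f-inj j with any? (λ i → f i Finₚ.≟ j)
... | yes preimage = preimage
... | no  ∄ = ⊥-elim (ℕₚ.1+n≰n (injective⇒≤ {f = λ i → punchOut (avoids i)}
                (λ {i} {i′} eq → f-inj (punchOut-injective (avoids i) (avoids i′) eq))))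
  where
  avoids : ∀ i → j ≢ f i
  avoids i j≡fi = ∄ (i , sym j≡fi)

dirIndex : Dir → Fin 4
dirIndex +e₁ = 0F
dirIndex -e₁ = 1F
dirIndex +e₂ = 2F
dirIndex -e₂ = 3F

dirAt : Fin 4 → Dir
dirAt 0F = +e₁
dirAt 1F = -e₁
dirAt 2F = +e₂
dirAt 3F = -e₂

dirAt-dirIndex : ∀ d → dirAt (dirIndex d) ≡ d
dirAt-dirIndex +e₁ = refl
dirAt-dirIndex -e₁ = refl
dirAt-dirIndex +e₂ = refl
dirAt-dirIndex -e₂ = refl

-- A full turn of the rotor serves each neighbour once, whatever the ordering: `dirIndex` after
-- `ord` is an injection of `Fin 4` into itself, hence a permutation.
sum-ordering : ∀ {ord : Fin 4 → Dir} → Injective _≡_ _≡_ ord → ∀ (f : Dir → ℚ) →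
  (f +e₁ + f -e₁) + (f +e₂ + f -e₂) ≡ f (ord 0F) + f (ord 1F) + f (ord 2F) + f (ord 3F)
sum-ordering {ord} ord-inj f = begin
  (f +e₁ + f -e₁) + (f +e₂ + f -e₂)   ≡⟨ reassoc₁ (f +e₁) (f -e₁) (f +e₂) (f -e₂) ⟩
  sum (λ i → f (dirAt i))             ≡⟨ sum-permute (λ i → f (dirAt i)) π ⟩
  sum (λ i → f (dirAt (rank i)))      ≡⟨ reassoc₂ (g 0F) (g 1F) (g 2F) (g 3F) ⟩
  g 0F + g 1F + g 2F + g 3F
    ≡⟨ cong₂ _+_ (cong₂ _+_ (cong₂ _+_ (unrank 0F) (unrank 1F)) (unrank 2F)) (unrank 3F) ⟩
  f (ord 0F) + f (ord 1F) + f (ord 2F) + f (ord 3F) ∎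
  where
  open ≡-Reasoning
  rank : Fin 4 → Fin 4
  rank i = dirIndex (ord i)
  g : Fin 4 → ℚ
  g i = f (dirAt (rank i))
  unrank : ∀ i → g i ≡ f (ord i)
  unrank i = cong f (dirAt-dirIndex (ord i))
  rank-inj : Injective _≡_ _≡_ rank
  rank-inj eq = ord-inj (trans (sym (dirAt-dirIndex _)) (trans (cong dirAt eq) (dirAt-dirIndex _)))
  inverse : ∀ j → ∃ λ i → rank i ≡ j
  inverse = injective⇒preimage rank-inj
  π : Permutation 4 4
  π = permutation rank (λ j → proj₁ (inverse j)) (λ j → proj₂ (inverse j))
        (λ i → rank-inj (proj₂ (inverse (rank i))))
  reassoc₁ : ∀ a b c d → (a + b) + (c + d) ≡ a + (b + (c + (d + 0ℚ)))
  reassoc₁ = solve-∀ ℚ-ring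
  reassoc₂ : ∀ a b c d → a + (b + (c + (d + 0ℚ))) ≡ a + b + c + d
  reassoc₂ = solve-∀ ℚ-ring

update-at : ∀ σ x v → update σ x v x ≡ v
update-at σ x v with x ≟ₛ x
... | yes _ = refl
... | no x≢x = ⊥-elim (x≢x refl)

update-away : ∀ σ x v {y} → y ≢ x → update σ x v y ≡ σ y
update-away σ x v {y} y≢x with y ≟ₛ x
... | yes y≡x = ⊥-elim (y≢x y≡x)
... | no _ = refl

-- Used mostly in the contrapositive: a site that is free after a walk was free all along, so the
-- particle never moved off it.
walk-occupied : ∀ {ord σ x σ′} → Walk ord σ x σ′ → ∀ {y} → Occupied σ y → Occupied σ′ y
walk-occupied (stop {σ} {x} _) {y} occ with y ≟ₛ x
... | yes _ = 0F , refl
... | no _ = occ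
walk-occupied {σ = σ} {x} (move {i = i} _ walk) {y} occ = walk-occupied walk updated
  where
  updated : Occupied (update σ x (just (next i))) y
  updated with y ≟ₛ x
  ... | yes _ = next i , refl
  ... | no _ = occ

-- The sum of f at the particle and the charges of the occupied sites grows by at least δ with each step
-- from a Subharmonic site: exactly δ while the rotor advances, and the excess of neighbourSum f y over
-- 4 (f y + δ) is gained when the rotor wraps around and the charge is reset.
module Charge (ord : Fin 4 → Dir) (ord-inj : Injective _≡_ _≡_ ord) (f : Site → ℚ) (δ : ℚ) where

  rise : Site → Fin 4 → ℚ
  rise y i = (f y + δ) - f (y ⊕ vec (ord i))

  charge : Site → Fin 4 → ℚ
  charge y 0F = f y
  charge y 1F = f y + rise y 0F
  charge y 2F = f y + rise y 0F + rise y 1F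
  charge y 3F = f y + rise y 0F + rise y 1F + rise y 2F

  private
    compensate : ∀ c p q → c + p ≡ c + (p - q) + q
    compensate = solve-∀ ℚ-ring

  Subharmonic : Site → Set
  Subharmonic y = ℕ→ℚ 4 * (f y + δ) ≤ neighbourSum f y

  charge-next : ∀ y → Subharmonic y → ∀ i →
    charge y i + (f y + δ) ≤ charge y (next i) + f (y ⊕ vec (ord i))
  charge-next y _ 0F = ≤-reflexive (compensate (charge y 0F) (f y + δ) (f (y ⊕ vec (ord 0F))))
  charge-next y _ 1F = ≤-reflexive (compensate (charge y 1F) (f y + δ) (f (y ⊕ vec (ord 1F))))
  charge-next y _ 2F = ≤-reflexive (compensate (charge y 2F) (f y + δ) (f (y ⊕ vec (ord 2F))))
  -- The wrap-around drops the three accumulated rises. Together with the rise of the present step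
  -- they amount to `4 (f y + δ)` minus the sum over all neighbours, which is at most 0 at a
  -- `Subharmonic` site.
  charge-next y sub 3F = begin
    f y + (p - n 0F) + (p - n 1F) + (p - n 2F) + p
      ≡⟨ collect (f y) p (n 0F) (n 1F) (n 2F) ⟩
    ℕ→ℚ 4 * p + (f y - n 0F - n 1F - n 2F)
      ≤⟨ +-monoˡ-≤ _ (subst (ℕ→ℚ 4 * p ≤_) (sum-ordering ord-inj (λ d → f (y ⊕ vec d))) sub) ⟩
    n 0F + n 1F + n 2F + n 3F
      + (f y - n 0F - n 1F - n 2F)
      ≡⟨ cancel (f y) (n 0F) (n 1F) (n 2F) (n 3F) ⟩
    f y + n 3F ∎
    where
    open ≤-Reasoning
    p = f y + δ
    n : Fin 4 → ℚ
    n i = f (y ⊕ vec (ord i))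
    collect : ∀ v p a b c → v + (p - a) + (p - b) + (p - c) + p ≡ ℕ→ℚ 4 * p + (v - a - b - c)
    collect = solve-∀ ℚ-ring
    cancel : ∀ v a b c d → a + b + c + d + (v - a - b - c) ≡ v + d
    cancel = solve-∀ ℚ-ring

  -- A charge consists of `f y` and at most three rises, and nonnegativity of `f` and `δ` bounds
  -- each of these by `f y + δ`.
  charge-≤ : (∀ y → 0ℚ ≤ f y) → 0ℚ ≤ δ → ∀ y i → charge y i ≤ ℕ→ℚ 4 * (f y + δ)
  charge-≤ 0≤f 0≤δ y = bound
    where
    p = f y + δ
    0≤p = 0≤-+ (0≤f y) 0≤δ
    rise≤p : ∀ i → rise y i ≤ p
    rise≤p i = subst (rise y i ≤_) (+-identityʳ p) (+-monoʳ-≤ p (neg-antimono-≤ (0≤f (y ⊕ vec (ord i)))))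
    enough : ∀ k → k ℕ.≤ 4 → ℕ→ℚ k * p ≤ ℕ→ℚ 4 * p
    enough k k≤4 = *-monoʳ-≤-nonNeg p {{nonNegative 0≤p}} (ℕ→ℚ-mono-≤ k≤4)
    append : ∀ k {c i} → c ≤ ℕ→ℚ k * p → c + rise y i ≤ ℕ→ℚ (suc k) * p
    append k {c} {i} c≤ = ≤-trans (+-mono-≤ c≤ (rise≤p i)) (≤-reflexive (begin
      ℕ→ℚ k * p + p         ≡⟨ distrib (ℕ→ℚ k) p ⟩
      (1ℚ + ℕ→ℚ k) * p      ≡⟨ cong (_* p) (ℕ→ℚ-homo-+ 1 k) ⟨
      ℕ→ℚ (suc k) * p       ∎))
      where
      open ≡-Reasoning
      distrib : ∀ k p → k * p + p ≡ (1ℚ + k) * p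
      distrib = solve-∀ ℚ-ring
    one : charge y 0F ≤ ℕ→ℚ 1 * p
    one = subst (f y ≤_) (sym (*-identityˡ p)) (p≤p+q (f y) 0≤δ)
    bound : ∀ i → charge y i ≤ ℕ→ℚ 4 * p
    bound 0F = ≤-trans one (enough 1 (ℕ.s≤s ℕ.z≤n))
    bound 1F = ≤-trans (append 1 one) (enough 2 (ℕ.s≤s (ℕ.s≤s ℕ.z≤n)))
    bound 2F = ≤-trans (append 2 (append 1 one)) (enough 3 (ℕ.s≤s (ℕ.s≤s (ℕ.s≤s ℕ.z≤n))))
    bound 3F = append 3 (append 2 (append 1 one))

  content : State → Site → ℚ
  content σ y = maybe (charge y) 0ℚ (σ y)

  content-update : ∀ x N σ {y v p q} → InBox x N y →
    maybe (charge y) 0ℚ (σ y) + p ≤ maybe (charge y) 0ℚ v + q →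
    sumBox x N (content σ) + p ≤ sumBox x N (content (update σ y v)) + q
  content-update x N σ {y} {v} {p} {q} y∈box at-y = sumBox-replace x N y∈box
    (λ z z≢y → ≤-reflexive (sym (cong (maybe (charge z) 0ℚ) (update-away σ y v z≢y))))
    (subst (λ w → content σ y + p ≤ maybe (charge y) 0ℚ w + q) (sym (update-at σ y v)) at-y)

  content-move : ∀ x N {σ y i} → InBox x N y → σ y ≡ just i → Subharmonic y →
    sumBox x N (content σ) + (f y + δ) ≤
    sumBox x N (content (update σ y (just (next i)))) + f (y ⊕ vec (ord i))
  content-move x N {σ} {y} {i} y∈box σy≡i sub = content-update x N σ y∈box
    (subst (λ w → maybe (charge y) 0ℚ w + (f y + δ) ≤ charge y (next i) + f (y ⊕ vec (ord i)))
      (sym σy≡i) (charge-next y sub i))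

  -- The value of `f` at the particle turns into the charge `f y` of the fresh rotor `0F`, so the
  -- books balance exactly.
  content-stop : ∀ x N {σ y} → InBox x N y → σ y ≡ nothing →
    sumBox x N (content σ) + f y ≤ sumBox x N (content (update σ y (just 0F)))
  content-stop x N {σ} {y} y∈box σy≡nothing = subst (sumBox x N (content σ) + f y ≤_) (+-identityʳ _)
    (content-update x N σ y∈box
      (subst (λ w → maybe (charge y) 0ℚ w + f y ≤ f y + 0ℚ) (sym σy≡nothing)
        (≤-reflexive (+-comm 0ℚ (f y)))))

-- The sum of |z|⁻² over a box

-- Multiply `P ≤ c * Q` by `q * p`.
reciprocal-anti : ∀ {p q P Q} c → p * P ≡ 1ℚ → q * Q ≡ 1ℚ → 0ℚ ≤ p → 0ℚ ≤ q → P ≤ c * Q → q ≤ c * p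
reciprocal-anti {p} {q} {P} {Q} c pP≡1 qQ≡1 0≤p 0≤q P≤cQ = begin
  q                 ≡⟨ *-identityʳ q ⟨
  q * 1ℚ            ≡⟨ cong (q *_) pP≡1 ⟨
  q * (p * P)       ≡⟨ *-assoc q p P ⟨
  q * p * P         ≤⟨ *-monoˡ-≤ (q * p) (0≤-* 0≤q 0≤p) P≤cQ ⟩
  q * p * (c * Q)   ≡⟨ rearrange q p c Q ⟩
  c * p * (q * Q)   ≡⟨ cong (c * p *_) qQ≡1 ⟩
  c * p * 1ℚ        ≡⟨ *-identityʳ (c * p) ⟩
  c * p             ∎
  where
  open ≤-Reasoning
  rearrange : ∀ q p c Q → q * p * (c * Q) ≡ c * p * (q * Q)
  rearrange = solve-∀ ℚ-ring

recip-anti : ∀ {i j} → i ℕ.≤ j → recip j ≤ recip i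
recip-anti {i} {j} i≤j = subst (recip j ≤_) (*-identityˡ (recip i))
  (reciprocal-anti 1ℚ (recip-inverse i) (recip-inverse j) (0≤recip i) (0≤recip j)
    (subst (ℕ→ℚ (suc i) ≤_) (sym (*-identityˡ (ℕ→ℚ (suc j)))) (ℕ→ℚ-mono-≤ (ℕ.s≤s i≤j))))

-- Dyadic blocks: with `n = 2 ^ k`, the `n` terms from index `n` on are each at most `1/n`, which is
-- `recip (ℕ.pred n)`. Doubling the range therefore adds at most 1.
harmonic-≤ : ∀ k → sumBelow (2 ℕ.^ k) recip ≤ ℕ→ℚ (suc k)
harmonic-≤ zero = ≤-refl
harmonic-≤ (suc k) = begin
  sumBelow (n ℕ.+ (n ℕ.+ 0)) recip
    ≡⟨ cong (λ j → sumBelow (n ℕ.+ j) recip) (ℕₚ.+-identityʳ n) ⟩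
  sumBelow (n ℕ.+ n) recip                                ≡⟨ sumBelow-+ n n recip ⟩
  sumBelow n recip + sumBelow n (λ i → recip (i ℕ.+ n))
    ≤⟨ +-mono-≤ (harmonic-≤ k) (sumBelow-mono n (λ i _ → recip-anti (ℕₚ.≤-trans (ℕₚ.pred[n]≤n {n}) (ℕₚ.m≤n+m n i)))) ⟩
  ℕ→ℚ (suc k) + sumBelow n (λ _ → recip (ℕ.pred n))
    ≡⟨ cong (_+_ (ℕ→ℚ (suc k))) (sumBelow-const n (recip (ℕ.pred n))) ⟩
  ℕ→ℚ (suc k) + ℕ→ℚ n * recip (ℕ.pred n)
    ≡⟨ cong (λ j → ℕ→ℚ (suc k) + ℕ→ℚ j * recip (ℕ.pred n)) (ℕₚ.suc-pred n {{ℕₚ.m^n≢0 2 k}}) ⟨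
  ℕ→ℚ (suc k) + ℕ→ℚ (suc (ℕ.pred n)) * recip (ℕ.pred n)
    ≡⟨ cong (_+_ (ℕ→ℚ (suc k))) (trans (*-comm (ℕ→ℚ (suc (ℕ.pred n))) (recip (ℕ.pred n))) (recip-inverse (ℕ.pred n))) ⟩
  ℕ→ℚ (suc k) + 1ℚ                                        ≡⟨ +-comm (ℕ→ℚ (suc k)) 1ℚ ⟩
  1ℚ + ℕ→ℚ (suc k)                                        ≡⟨ ℕ→ℚ-homo-+ 1 (suc k) ⟨
  ℕ→ℚ (suc (suc k))                                       ∎
  where
  open ≤-Reasoning
  n = 2 ℕ.^ k

-- Equal to `1 / (1 + i)` for `i ≥ 0` and to `1 / |i|` for `i < 0`: at least `1 / (1 + |i|)`
-- everywhere, and with the same harmonic sum over both halves of a window.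
weight : ℤ → ℚ
weight i = recip (index i)

0≤weight : ∀ i → 0ℚ ≤ weight i
0≤weight i = 0≤recip (index i)

weight-sum-≤ : ∀ k → sumWindow (2 ℕ.^ k) weight ≤ ℕ→ℚ 2 * ℕ→ℚ (suc k)
weight-sum-≤ k = begin
  sumBelow (2 ℕ.^ k) (λ i → recip i + recip i)
    ≤⟨ sumBelow-mono (2 ℕ.^ k) (λ i _ → ≤-reflexive (double (recip i))) ⟩
  sumBelow (2 ℕ.^ k) (λ i → ℕ→ℚ 2 * recip i)      ≡⟨ sumBelow-* (2 ℕ.^ k) (ℕ→ℚ 2) recip ⟩
  ℕ→ℚ 2 * sumBelow (2 ℕ.^ k) recip                ≤⟨ *-monoˡ-≤ (ℕ→ℚ 2) (0≤ℕ→ℚ 2) (harmonic-≤ k) ⟩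
  ℕ→ℚ 2 * ℕ→ℚ (suc k)                             ∎
  where
  open ≤-Reasoning
  double : ∀ p → p + p ≡ ℕ→ℚ 2 * p
  double = solve-∀ ℚ-ring

index≤∣∣ : ∀ i → index i ℕ.≤ ℤ.∣ i ∣
index≤∣∣ (+ n) = ℕₚ.≤-refl
index≤∣∣ -[1+ n ] = ℕₚ.n≤1+n n

n≤n*n : ∀ n → n ℕ.≤ n ℕ.* n
n≤n*n zero = ℕ.z≤n
n≤n*n (suc n) = ℕₚ.m≤m*n (suc n) (suc n)

product-≤-squares : ∀ u v → u ℕ.* v ℕ.≤ u ℕ.* u ℕ.+ v ℕ.* v
product-≤-squares u v with ℕₚ.≤-total u v
... | inj₁ u≤v = ℕₚ.≤-trans (ℕₚ.*-monoˡ-≤ v u≤v) (ℕₚ.m≤n+m (v ℕ.* v) (u ℕ.* u))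
... | inj₂ v≤u = ℕₚ.≤-trans (ℕₚ.*-monoʳ-≤ u v≤u) (ℕₚ.m≤m+n (u ℕ.* u) (v ℕ.* v))

-- Expand the product as `1 + (u + v) + u v`; each of the three summands is at most `u² + v²`.
successors-≤-norm : ∀ u v → 1 ℕ.≤ u ℕ.* u ℕ.+ v ℕ.* v →
  suc u ℕ.* suc v ℕ.≤ 3 ℕ.* (u ℕ.* u ℕ.+ v ℕ.* v)
successors-≤-norm u v 1≤s = begin
  suc u ℕ.* suc v                 ≡⟨ expand u v ⟩
  1 ℕ.+ (u ℕ.+ v) ℕ.+ u ℕ.* v
    ≤⟨ ℕₚ.+-mono-≤ (ℕₚ.+-mono-≤ 1≤s (ℕₚ.+-mono-≤ (n≤n*n u) (n≤n*n v))) (product-≤-squares u v) ⟩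
  s ℕ.+ s ℕ.+ s                   ≡⟨ triple s ⟩
  3 ℕ.* s                         ∎
  where
  open ℕₚ.≤-Reasoning
  s = u ℕ.* u ℕ.+ v ℕ.* v
  expand : ∀ u v → suc u ℕ.* suc v ≡ 1 ℕ.+ (u ℕ.+ v) ℕ.+ u ℕ.* v
  expand = ℕRing.solve-∀
  triple : ∀ s → s ℕ.+ s ℕ.+ s ≡ 3 ℕ.* s
  triple = ℕRing.solve-∀

-- A bound of product form lets the sum over a box factor into two harmonic sums.
φ-≤-weights : ∀ a b → φ (a , b) ≤ ℕ→ℚ 3 * (weight a * weight b)
φ-≤-weights a b = helper (norm (a , b)) refl
  where
  helper : ∀ s → norm (a , b) ≡ s → φ (a , b) ≤ ℕ→ℚ 3 * (weight a * weight b)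
  -- At the pole both weights are 1, and both sides equal 3.
  helper zero eq with refl ← norm≡0⇒≡origin (a , b) eq = ≤-refl
  helper (suc s) eq = reciprocal-anti (ℕ→ℚ 3) weights-inverse
    (reciprocalOrPole-inverse (norm (a , b)) (λ eq₀ → ℕₚ.1+n≢0 (trans (sym eq) eq₀)))
    (0≤-* (0≤weight a) (0≤weight b)) (0≤φ (a , b)) bound
    where
    i = index a
    j = index b
    weights-inverse : weight a * weight b * (ℕ→ℚ (suc i) * ℕ→ℚ (suc j)) ≡ 1ℚ
    weights-inverse = trans (rearrange (weight a) (weight b) (ℕ→ℚ (suc i)) (ℕ→ℚ (suc j)))
      (cong₂ _*_ (recip-inverse i) (recip-inverse j))
      where
      rearrange : ∀ p q P Q → p * q * (P * Q) ≡ (p * P) * (q * Q)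
      rearrange = solve-∀ ℚ-ring
    bound : ℕ→ℚ (suc i) * ℕ→ℚ (suc j) ≤ ℕ→ℚ 3 * ℕ→ℚ (norm (a , b))
    bound = subst₂ _≤_ (ℕ→ℚ-homo-* (suc i) (suc j)) (ℕ→ℚ-homo-* 3 (norm (a , b)))
      (ℕ→ℚ-mono-≤ (ℕₚ.≤-trans
        (ℕₚ.*-mono-≤ (ℕ.s≤s (index≤∣∣ a)) (ℕ.s≤s (index≤∣∣ b)))
        (successors-≤-norm ℤ.∣ a ∣ ℤ.∣ b ∣ (subst (1 ℕ.≤_) (sym eq) (ℕ.s≤s ℕ.z≤n)))))

-- The summand is the bound of `charge-≤` with `δ = 0`. The constant is `48 = 4 * 3 * 2 * 2`: the
-- factor of that bound, the factor of `φ-≤-weights`, and 2 for each two-sided harmonic sum.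
φ-sum-≤ : ∀ x k → sumBox x (2 ℕ.^ k) (λ y → ℕ→ℚ 4 * (φ (y ⊖ x) + 0ℚ)) ≤ ℕ→ℚ (48 ℕ.* (suc k ℕ.* suc k))
φ-sum-≤ x@(x₁ , x₂) k = begin
  sumBox x N (λ y → ℕ→ℚ 4 * (φ (y ⊖ x) + 0ℚ))
    ≤⟨ sumWindow-mono N (λ a → sumWindow-mono N (λ b → pointwise a b)) ⟩
  sumWindow N (λ a → sumWindow N (λ b → ℕ→ℚ 12 * weight a * weight b))
    ≤⟨ sumWindow-mono N (λ a → ≤-reflexive (trans (sumWindow-* N (ℕ→ℚ 12 * weight a) weight) (exchange (ℕ→ℚ 12) (weight a) W))) ⟩
  sumWindow N (λ a → ℕ→ℚ 12 * W * weight a)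
    ≡⟨ sumWindow-* N (ℕ→ℚ 12 * W) weight ⟩
  ℕ→ℚ 12 * W * W
    ≤⟨ *-mono-≤ (0≤-* (0≤ℕ→ℚ 12) 0≤W) 0≤W (*-monoˡ-≤ (ℕ→ℚ 12) (0≤ℕ→ℚ 12) (weight-sum-≤ k)) (weight-sum-≤ k) ⟩
  ℕ→ℚ 12 * (ℕ→ℚ 2 * ℕ→ℚ (suc k)) * (ℕ→ℚ 2 * ℕ→ℚ (suc k))
    ≡⟨ collect (ℕ→ℚ (suc k)) ⟩
  ℕ→ℚ 48 * (ℕ→ℚ (suc k) * ℕ→ℚ (suc k))
    ≡⟨ cong (ℕ→ℚ 48 *_) (ℕ→ℚ-homo-* (suc k) (suc k)) ⟨
  ℕ→ℚ 48 * ℕ→ℚ (suc k ℕ.* suc k)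
    ≡⟨ ℕ→ℚ-homo-* 48 (suc k ℕ.* suc k) ⟨
  ℕ→ℚ (48 ℕ.* (suc k ℕ.* suc k)) ∎
  where
  open ≤-Reasoning
  N = 2 ℕ.^ k
  W = sumWindow N weight
  0≤W : 0ℚ ≤ W
  0≤W = sumBelow-0≤ N (λ i → 0≤-+ (0≤weight (+ i)) (0≤weight -[1+ i ]))
  exchange : ∀ p q r → p * q * r ≡ p * r * q
  exchange = solve-∀ ℚ-ring
  collect : ∀ p → ℕ→ℚ 12 * (ℕ→ℚ 2 * p) * (ℕ→ℚ 2 * p) ≡ ℕ→ℚ 48 * (p * p)
  collect = solve-∀ ℚ-ring
  factor : ∀ p q → ℕ→ℚ 4 * (ℕ→ℚ 3 * (p * q)) ≡ ℕ→ℚ 12 * p * q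
  factor = solve-∀ ℚ-ring
  pointwise : ∀ a b → ℕ→ℚ 4 * (φ ((x ⊕ (a , b)) ⊖ x) + 0ℚ) ≤ ℕ→ℚ 12 * weight a * weight b
  pointwise a b = subst₂ (λ z r → ℕ→ℚ 4 * z ≤ r)
    (trans (cong φ (sym (cong₂ _,_ ([i+j]-i≡j x₁ a) ([i+j]-i≡j x₂ b)))) (sym (+-identityʳ _)))
    (factor (weight a) (weight b))
    (*-monoˡ-≤ (ℕ→ℚ 4) (0≤ℕ→ℚ 4) (φ-≤-weights a b))

-- Existence of the process

Bounded : ℕ → Site → Set
Bounded R (a , b) = ℤ.∣ a ∣ ℕ.≤ R × ℤ.∣ b ∣ ℕ.≤ R

Bounded-suc : ∀ {R y} → Bounded R y → Bounded (suc R) y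
Bounded-suc (a≤R , b≤R) = ℕₚ.m≤n⇒m≤1+n a≤R , ℕₚ.m≤n⇒m≤1+n b≤R

Bounded-step : ∀ {R} y d → Bounded R y → Bounded (suc R) (y ⊕ vec d)
Bounded-step {R} (a , b) d (a≤R , b≤R) =
  stepped a (proj₁ (vec d)) a≤R (coordinate₁ d) , stepped b (proj₂ (vec d)) b≤R (coordinate₂ d)
  where
  stepped : ∀ i j → ℤ.∣ i ∣ ℕ.≤ R → ℤ.∣ j ∣ ℕ.≤ 1 → ℤ.∣ i ℤ.+ j ∣ ℕ.≤ suc R
  stepped i j i≤R j≤1 = subst (ℤ.∣ i ℤ.+ j ∣ ℕ.≤_) (ℕₚ.+-comm R 1)
    (ℕₚ.≤-trans (ℤₚ.∣i+j∣≤∣i∣+∣j∣ i j) (ℕₚ.+-mono-≤ i≤R j≤1))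
  coordinate₁ : ∀ d → ℤ.∣ proj₁ (vec d) ∣ ℕ.≤ 1
  coordinate₁ +e₁ = ℕₚ.≤-refl
  coordinate₁ -e₁ = ℕₚ.≤-refl
  coordinate₁ +e₂ = ℕ.z≤n
  coordinate₁ -e₂ = ℕ.z≤n
  coordinate₂ : ∀ d → ℤ.∣ proj₂ (vec d) ∣ ℕ.≤ 1
  coordinate₂ +e₁ = ℕ.z≤n
  coordinate₂ -e₁ = ℕ.z≤n
  coordinate₂ +e₂ = ℕₚ.≤-refl
  coordinate₂ -e₂ = ℕₚ.≤-refl

Bounded⇒InBox : ∀ {R K N x y} → Bounded R y → Bounded K x → R ℕ.+ K ℕ.< N → InBox x N y
Bounded⇒InBox {R} {K} {N} {x₁ , x₂} {y₁ , y₂} (y₁≤R , y₂≤R) (x₁≤K , x₂≤K) R+K<N =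
  coordinate y₁ x₁ y₁≤R x₁≤K , coordinate y₂ x₂ y₂≤R x₂≤K
  where
  coordinate : ∀ i j → ℤ.∣ i ∣ ℕ.≤ R → ℤ.∣ j ∣ ℕ.≤ K → index (i ℤ.- j) ℕ.< N
  coordinate i j i≤R j≤K = ℕₚ.≤-<-trans (index≤∣∣ (i ℤ.- j))
    (ℕₚ.≤-<-trans (ℤₚ.∣i-j∣≤∣i∣+∣j∣ i j) (ℕₚ.≤-<-trans (ℕₚ.+-mono-≤ i≤R j≤K) R+K<N))

occupied-update : ∀ {σ x i y} → Occupied (update σ x (just i)) y → y ≡ x ⊎ Occupied σ y
occupied-update {x = x} {y = y} occ with y ≟ₛ x
... | yes y≡x = inj₁ y≡x
... | no _ = inj₂ occ

occupied-move : ∀ {σ x i j y} → σ x ≡ just i → Occupied (update σ x (just j)) y → Occupied σ y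
occupied-move {σ} {x} {j = j} {y} σx≡i occ with occupied-update {σ} {x} {j} {y} occ
... | inj₁ refl = _ , σx≡i
... | inj₂ occ′ = occ′

-- A particle moves on only from occupied sites, which lie within `R`, so no step takes it beyond
-- `suc R`.
walk-bounded : ∀ {ord R σ x σ′} → Walk ord σ x σ′ →
  (∀ {y} → Occupied σ y → Bounded R y) → Bounded (suc R) x →
  ∀ {y} → Occupied σ′ y → Bounded (suc R) y
walk-bounded (stop {σ} {x} _) bounded x-bounded {y} occ with occupied-update {σ} {x} {0F} {y} occ
... | inj₁ refl = x-bounded
... | inj₂ occ′ = Bounded-suc {y = y} (bounded {y} occ′)
walk-bounded {ord} {σ = σ} {x} (move {i = i} σx≡i walk) bounded _ = walk-bounded walk
  (λ {y} occ → bounded (occupied-move {σ} {x} {i} {next i} {y} σx≡i occ))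
  (Bounded-step x (ord i) (bounded (i , σx≡i)))

deposited-bounded : ∀ {ord m σ} → Deposited ord m σ → ∀ {y} → Occupied σ y → Bounded m y
deposited-bounded init (_ , ())
deposited-bounded (add deposited walk) = walk-bounded walk (λ {y} → deposited-bounded deposited {y}) (ℕ.z≤n , ℕ.z≤n)

p<p+1 : ∀ p → p < p + 1ℚ
p<p+1 p = subst (_< p + 1ℚ) (+-identityʳ p) (+-monoʳ-< p (toWitness {a? = 0ℚ <? 1ℚ} _))

module Existence (ord : Fin 4 → Dir) (ord-inj : Injective _≡_ _≡_ ord) where

  normℚ : Site → ℚ
  normℚ y = ℕ→ℚ (norm y)

  open Charge ord ord-inj normℚ 1ℚ

  -- The mean of `|y|²` over the four neighbours is exactly `|y|² + 1`, which is where the gain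
  -- `δ = 1` comes from.
  normℚ-subharmonic : ∀ y → Subharmonic y
  normℚ-subharmonic y = ≤-reflexive (begin
    ℕ→ℚ 4 * (normℚ y + 1ℚ)                                      ≡⟨ halves (normℚ y) ⟩
    ℕ→ℚ 2 * (1ℚ + normℚ y) + ℕ→ℚ 2 * (1ℚ + normℚ y)             ≡⟨ cong₂ _+_
        (cast-sum (norm (y ⊕ vec +e₁)) (norm (y ⊕ vec -e₁)) (norm y) (norm-sum₁ y))
        (cast-sum (norm (y ⊕ vec +e₂)) (norm (y ⊕ vec -e₂)) (norm y) (norm-sum₂ y)) ⟨
    neighbourSum normℚ y ∎)
    where
    open ≡-Reasoning
    halves : ∀ s → ℕ→ℚ 4 * (s + 1ℚ) ≡ ℕ→ℚ 2 * (1ℚ + s) + ℕ→ℚ 2 * (1ℚ + s)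
    halves = solve-∀ ℚ-ring

  -- The first summand bounds the charge at `y`. The second leaves room for the particle's own term
  -- at every site, so that the total does not depend on where the particle stands.
  cap : Site → ℚ
  cap y = ℕ→ℚ 4 * (normℚ y + 1ℚ) + (normℚ y + 1ℚ)

  module _ (N : ℕ) where

    energy : State → Site → ℚ
    energy σ x = sumBox origin N (content σ) + normℚ x

    energy-≤ : ∀ σ x → InBox origin N x → energy σ x ≤ sumBox origin N cap
    energy-≤ σ x x∈box = subst (energy σ x ≤_) (+-identityʳ _) (sumBox-replace origin N x∈box
      (λ y _ → ≤-trans (content-≤ y) (p≤p+q _ (0≤p y)))
      (subst (content σ x + normℚ x ≤_) (sym (+-identityʳ (cap x)))
        (+-mono-≤ (content-≤ x) (p≤p+q (normℚ x) (0≤ℕ→ℚ 1)))))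
      where
      0≤p : ∀ y → 0ℚ ≤ normℚ y + 1ℚ
      0≤p y = 0≤-+ (0≤ℕ→ℚ (norm y)) (0≤ℕ→ℚ 1)
      content-≤ : ∀ y → content σ y ≤ ℕ→ℚ 4 * (normℚ y + 1ℚ)
      content-≤ y with σ y
      ... | nothing = 0≤-* (0≤ℕ→ℚ 4) (0≤p y)
      ... | just i = charge-≤ (λ y → 0≤ℕ→ℚ (norm y)) (0≤ℕ→ℚ 1) y i

    -- Each move raises the energy by at least 1 and spends one unit of fuel, so the inequality
    -- persists. Without fuel it puts the energy above the cap, which cannot happen on an occupied
    -- site, as these lie in the box; the particle must have stopped by then.
    walk-within : ∀ fuel σ x → (∀ {y} → Occupied σ y → InBox origin N y) →
      sumBox origin N cap < energy σ x + ℕ→ℚ fuel → ∃ λ σ′ → Walk ord σ x σ′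
    walk-within fuel σ x support enough = helper fuel enough (σ x) refl
      where
      helper : ∀ fuel → sumBox origin N cap < energy σ x + ℕ→ℚ fuel → ∀ w → σ x ≡ w → ∃ λ σ′ → Walk ord σ x σ′
      helper _ _ nothing σx≡ = _ , stop σx≡
      helper zero enough (just i) σx≡ = ⊥-elim (<⇒≱ (subst (sumBox origin N cap <_) (+-identityʳ (energy σ x)) enough)
        (energy-≤ σ x (support (i , σx≡))))
        where
        <⇒≱ : ∀ {p q} → p < q → ¬ (q ≤ p)
        <⇒≱ p<q q≤p = <-irrefl refl (<-≤-trans p<q q≤p)
      helper (suc fuel) enough (just i) σx≡ =
        map₂ (move σx≡) (walk-within fuel σ₁ (x ⊕ vec (ord i))
          (λ {y} occ → support (occupied-move {σ} {x} {i} {next i} {y} σx≡ occ))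
          (<-≤-trans enough (begin
            energy σ x + ℕ→ℚ (suc fuel)         ≡⟨ cong (_+_ (energy σ x)) (ℕ→ℚ-homo-+ 1 fuel) ⟩
            energy σ x + (1ℚ + ℕ→ℚ fuel)
              ≡⟨ regroup (sumBox origin N (content σ)) (normℚ x) (ℕ→ℚ fuel) ⟩
            sumBox origin N (content σ) + (normℚ x + 1ℚ) + ℕ→ℚ fuel
              ≤⟨ +-monoˡ-≤ (ℕ→ℚ fuel) (content-move origin N {σ} {x} {i} (support (i , σx≡)) σx≡ (normℚ-subharmonic x)) ⟩
            energy σ₁ (x ⊕ vec (ord i)) + ℕ→ℚ fuel ∎)))
        where
        open ≤-Reasoning
        σ₁ = update σ x (just (next i))
        regroup : ∀ p q r → p + q + (1ℚ + r) ≡ p + (q + 1ℚ) + r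
        regroup = solve-∀ ℚ-ring

  walk-exists : ∀ R σ x → (∀ {y} → Occupied σ y → Bounded R y) → ∃ λ σ′ → Walk ord σ x σ′
  walk-exists R σ x bounded = walk-within (suc R) (proj₁ enough) σ x
    (λ {y} occ → Bounded⇒InBox {x = origin} {y} (bounded {y} occ) (ℕ.z≤n , ℕ.z≤n) (ℕ.s≤s (ℕₚ.≤-reflexive (ℕₚ.+-identityʳ R))))
    (<-≤-trans (p<p+1 t) (subst (_≤ e + ℕ→ℚ (proj₁ enough)) (complete e t) (+-monoʳ-≤ e (proj₂ enough))))
    where
    t = sumBox origin (suc R) cap
    e = energy (suc R) σ x
    -- The extra 1 makes energy and fuel together exceed the cap strictly.
    enough = archimedean ((t - e) + 1ℚ)
    complete : ∀ e t → e + ((t - e) + 1ℚ) ≡ t + 1ℚ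
    complete = solve-∀ ℚ-ring

  deposited-exists : ∀ m → ∃ λ σ → Deposited ord m σ
  deposited-exists zero = empty , init
  deposited-exists (suc m) with deposited-exists m
  ... | σ , deposited = map₂ (add deposited) (walk-exists m σ origin (λ {y} → deposited-bounded deposited {y}))

-- The estimate at an unoccupied site

nothing≢just : ∀ {i : Fin 4} → nothing ≢ just i
nothing≢just ()

module Estimate (ord : Fin 4 → Dir) (ord-inj : Injective _≡_ _≡_ ord) (x : Site) where

  φₓ : Site → ℚ
  φₓ y = φ (y ⊖ x)

  open Charge ord ord-inj φₓ 0ℚ

  ⊖-origin : ∀ {y} → y ⊖ x ≡ origin → y ≡ x
  ⊖-origin {y₁ , y₂} eq =
    cong₂ _,_ (ℤₚ.i-j≡0⇒i≡j y₁ (proj₁ x) (cong proj₁ eq)) (ℤₚ.i-j≡0⇒i≡j y₂ (proj₂ x) (cong proj₂ eq))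

  ⊕-⊖ : ∀ y v → (y ⊕ v) ⊖ x ≡ (y ⊖ x) ⊕ v
  ⊕-⊖ (y₁ , y₂) (v₁ , v₂) = cong₂ _,_ (commute y₁ v₁ (proj₁ x)) (commute y₂ v₂ (proj₂ x))
    where
    commute : ∀ i j k → (i ℤ.+ j) ℤ.- k ≡ (i ℤ.- k) ℤ.+ j
    commute = ℤRing.solve-∀

  φₓ-subharmonic : ∀ y → y ≢ x → Subharmonic y
  φₓ-subharmonic y y≢x = subst₂ _≤_ (cong (ℕ→ℚ 4 *_) (sym (+-identityʳ (φₓ y))))
    (sym (cong₂ _+_ (cong₂ _+_ (shift +e₁) (shift -e₁)) (cong₂ _+_ (shift +e₂) (shift -e₂))))
    (φ-subharmonic (y ⊖ x) (λ eq → y≢x (⊖-origin eq)))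
    where
    shift : ∀ d → φₓ (y ⊕ vec d) ≡ φ ((y ⊖ x) ⊕ vec d)
    shift d = cong φ (⊕-⊖ y (vec d))

  module _ (N : ℕ) where

    total : State → ℚ
    total σ = sumBox x N (content σ)

    -- Every site that the particle moves off is occupied at the end, whereas `x` is not; so each
    -- move starts where `φₓ` is subharmonic. For the same reason it suffices that the final support
    -- lies in the box.
    walk-total : ∀ {σ y σ′} → Walk ord σ y σ′ → σ′ x ≡ nothing →
      (∀ {z} → Occupied σ′ z → InBox x N z) → total σ + φₓ y ≤ total σ′
    walk-total (stop {σ} {y} σy≡) _ support =
      content-stop x N {σ} {y} (support {y} (zero , update-at σ y (just zero))) σy≡
    walk-total {σ} {y} {σ′} (move {i = i} σy≡ walk) x-free support = begin
      total σ + φₓ y            ≡⟨ cong (_+_ (total σ)) (+-identityʳ (φₓ y)) ⟨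
      total σ + (φₓ y + 0ℚ)
        ≤⟨ content-move x N {σ} {y} {i} (support {y} y-occupied) σy≡ (φₓ-subharmonic y y≢x) ⟩
      _                         ≤⟨ walk-total walk x-free (λ {z} → support {z}) ⟩
      total σ′                  ∎
      where
      open ≤-Reasoning
      y-occupied : Occupied σ′ y
      y-occupied = walk-occupied (move σy≡ walk) {y} (i , σy≡)
      y≢x : y ≢ x
      y≢x refl = nothing≢just (trans (sym x-free) (proj₂ y-occupied))

    -- Each particle starts at the origin and so brings in `φₓ origin`, none of which its walk
    -- loses.
    deposited-total : ∀ {m σ} → Deposited ord m σ → σ x ≡ nothing →
      (∀ {z} → Occupied σ z → InBox x N z) → ℕ→ℚ m * φₓ origin ≤ total σ
    deposited-total init _ _ = subst (_≤ total empty) (sym (*-zeroˡ (φₓ origin)))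
      (sumBox-0≤ x N (λ y → ≤-refl))
    deposited-total {suc m} {σ′} (add {σ = σ} deposited walk) x-free support = begin
      ℕ→ℚ (suc m) * φₓ origin              ≡⟨ cong (_* φₓ origin) (ℕ→ℚ-homo-+ 1 m) ⟩
      (1ℚ + ℕ→ℚ m) * φₓ origin             ≡⟨ distrib (ℕ→ℚ m) (φₓ origin) ⟩
      ℕ→ℚ m * φₓ origin + φₓ origin        ≤⟨ +-monoˡ-≤ (φₓ origin) (deposited-total deposited
                                                (was-free (σ x) refl)
                                                (λ {z} occ → support {z} (walk-occupied walk {z} occ))) ⟩
      total σ + φₓ origin                  ≤⟨ walk-total walk x-free (λ {z} → support {z}) ⟩
      total σ′                             ∎
      where
      open ≤-Reasoning
      distrib : ∀ p q → (1ℚ + p) * q ≡ p * q + q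
      distrib = solve-∀ ℚ-ring
      was-free : ∀ w → σ x ≡ w → σ x ≡ nothing
      was-free nothing eq = eq
      was-free (just i) eq = ⊥-elim (nothing≢just (trans (sym x-free) (proj₂ (walk-occupied walk {x} (i , eq)))))

    total-≤ : ∀ σ → total σ ≤ sumBox x N (λ y → ℕ→ℚ 4 * (φₓ y + 0ℚ))
    total-≤ σ = sumBox-mono x N content-≤
      where
      content-≤ : ∀ y → content σ y ≤ ℕ→ℚ 4 * (φₓ y + 0ℚ)
      content-≤ y with σ y
      ... | nothing = 0≤-* (0≤ℕ→ℚ 4) (0≤-+ (0≤φ (y ⊖ x)) (≤-refl {0ℚ}))
      ... | just i = charge-≤ (λ y → 0≤φ (y ⊖ x)) (≤-refl {0ℚ}) y i

  norm-origin-⊖ : norm (origin ⊖ x) ≡ norm x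
  norm-origin-⊖ = cong₂ (λ m n → m ℕ.* m ℕ.+ n ℕ.* n) (abs-0-i (proj₁ x)) (abs-0-i (proj₂ x))
    where
    abs-0-i : ∀ i → ℤ.∣ + 0 ℤ.- i ∣ ≡ ℤ.∣ i ∣
    abs-0-i i = trans (cong ℤ.∣_∣ (ℤₚ.+-identityˡ (ℤ.- i))) (ℤₚ.∣-i∣≡∣i∣ i)

  -- Already an inner radius of order √m / log m.
  free⇒particles-≤ : ∀ {m σ K} k → Deposited ord m σ → σ x ≡ nothing → norm x ≢ 0 →
    Bounded K x → m ℕ.+ K ℕ.< 2 ℕ.^ k → m ℕ.≤ 48 ℕ.* (suc k ℕ.* suc k) ℕ.* norm x
  free⇒particles-≤ {m} {σ} k deposited x-free s≢0 x≤K m+K<N = ℕ→ℚ-cancel-≤ (begin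
    ℕ→ℚ m                                 ≡⟨ *-identityʳ (ℕ→ℚ m) ⟨
    ℕ→ℚ m * 1ℚ                            ≡⟨ cong (ℕ→ℚ m *_) inverse ⟨
    ℕ→ℚ m * (φₓ origin * ℕ→ℚ s)           ≡⟨ *-assoc (ℕ→ℚ m) (φₓ origin) (ℕ→ℚ s) ⟨
    ℕ→ℚ m * φₓ origin * ℕ→ℚ s             ≤⟨ *-monoʳ-≤-nonNeg (ℕ→ℚ s) {{nonNegative (0≤ℕ→ℚ s)}} (begin
      ℕ→ℚ m * φₓ origin                              ≤⟨ deposited-total N deposited x-free
                                                         (λ {z} occ → Bounded⇒InBox {x = x} {z} (deposited-bounded deposited {z} occ) x≤K m+K<N) ⟩
      total N σ                                      ≤⟨ total-≤ N σ ⟩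
      sumBox x N (λ y → ℕ→ℚ 4 * (φₓ y + 0ℚ))         ≤⟨ φ-sum-≤ x k ⟩
      ℕ→ℚ (48 ℕ.* (suc k ℕ.* suc k))                 ∎) ⟩
    ℕ→ℚ (48 ℕ.* (suc k ℕ.* suc k)) * ℕ→ℚ s           ≡⟨ ℕ→ℚ-homo-* (48 ℕ.* (suc k ℕ.* suc k)) s ⟨
    ℕ→ℚ (48 ℕ.* (suc k ℕ.* suc k) ℕ.* s)             ∎)
    where
    open ≤-Reasoning
    N = 2 ℕ.^ k
    s = norm x
    inverse : φₓ origin * ℕ→ℚ s ≡ 1ℚ
    inverse = trans (cong (λ n → reciprocalOrPole n * ℕ→ℚ s) norm-origin-⊖) (reciprocalOrPole-inverse s s≢0)

-- The disc in terms of the integer norm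

^ℚ-0≤ : ∀ {p} → 0ℚ ≤ p → ∀ n → 0ℚ ≤ p ^ℚ n
^ℚ-0≤ 0≤p zero = 0≤ℕ→ℚ 1
^ℚ-0≤ 0≤p (suc n) = 0≤-* 0≤p (^ℚ-0≤ 0≤p n)

^ℚ-mono-≤ : ∀ {p q} → 0ℚ ≤ p → p ≤ q → ∀ n → p ^ℚ n ≤ q ^ℚ n
^ℚ-mono-≤ 0≤p p≤q zero = ≤-refl
^ℚ-mono-≤ 0≤p p≤q (suc n) = *-mono-≤ 0≤p (^ℚ-0≤ 0≤p n) p≤q (^ℚ-mono-≤ 0≤p p≤q n)

-- Of the factor e^(6+ε) in the radius only e^(6+ε) ≥ 1 is used.
disc⇒norm² : ∀ {m ε} x → 0ℚ < ε → InDisc m ε x → norm x ℕ.* norm x ℕ.≤ 3 ℕ.* m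
disc⇒norm² {m} {ε} x@(a , b) 0<ε (n , y<n , inside) with norm x ℕ.* norm x ℕₚ.≤? 3 ℕ.* m
... | yes s²≤3m = s²≤3m
... | no s²≰3m = ⊥-elim (<-irrefl refl (<-≤-trans inside (begin
    ℕ→ℚ (8 ℕ.* m) * (ℕ→ℚ n - y) ^ℚ n
      ≤⟨ *-mono-≤ (0≤ℕ→ℚ (8 ℕ.* m)) (^ℚ-0≤ 0≤n-y n) (ℕ→ℚ-mono-≤ 8m≤3s²) (^ℚ-mono-≤ 0≤n-y n-y≤n n) ⟩
    ℕ→ℚ (3 ℕ.* (s ℕ.* s)) * ℕ→ℚ n ^ℚ n              ≡⟨ cong (_* ℕ→ℚ n ^ℚ n) cast ⟩
    ℕ→ℚ 3 * (normSq x ^ℚ 2) * ℕ→ℚ n ^ℚ n            ∎)))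
  where
  open ≤-Reasoning
  s = norm x
  y = ℕ→ℚ 6 + ε
  0≤y : 0ℚ ≤ y
  0≤y = 0≤-+ (0≤ℕ→ℚ 6) (<⇒≤ 0<ε)
  0≤n-y : 0ℚ ≤ ℕ→ℚ n - y
  0≤n-y = p≤q⇒0≤q-p (<⇒≤ y<n)
  n-y≤n : ℕ→ℚ n - y ≤ ℕ→ℚ n
  n-y≤n = subst (ℕ→ℚ n - y ≤_) (+-identityʳ (ℕ→ℚ n)) (+-monoʳ-≤ (ℕ→ℚ n) (neg-antimono-≤ 0≤y))
  -- The coefficient 3 is 8/3 rounded up: `s² > 3m` gives `3s² ≥ 9m ≥ 8m`, contrary to membership in
  -- the disc.
  8m≤3s² : 8 ℕ.* m ℕ.≤ 3 ℕ.* (s ℕ.* s)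
  8m≤3s² = ℕₚ.≤-trans (ℕₚ.*-monoˡ-≤ m (ℕₚ.m≤n+m 8 1))
    (subst (ℕ._≤ 3 ℕ.* (s ℕ.* s)) (sym (ℕₚ.*-assoc 3 3 m)) (ℕₚ.*-monoʳ-≤ 3 (ℕₚ.<⇒≤ (ℕₚ.≰⇒> s²≰3m))))
  cast : ℕ→ℚ (3 ℕ.* (s ℕ.* s)) ≡ ℕ→ℚ 3 * (normSq x ^ℚ 2)
  cast = trans (ℕ→ℚ-homo-* 3 (s ℕ.* s)) (cong (ℕ→ℚ 3 *_) (trans (ℕ→ℚ-homo-* s s)
    (cong₂ _*_ (cong ℤ→ℚ (+norm a b)) (trans (cong ℤ→ℚ (+norm a b)) (sym (*-identityʳ (normSq x)))))))

-- Powers of two against fourth powers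

power-above : ∀ n → ∃ λ k → suc n ℕ.< 2 ℕ.^ k × 2 ℕ.^ k ℕ.≤ 2 ℕ.* suc n
power-above zero = 1 , ℕₚ.≤-refl , ℕₚ.≤-refl
power-above (suc n) with power-above n
... | k , n<2^k , 2^k≤2n with suc (suc n) ℕₚ.<? 2 ℕ.^ k
...   | yes n+1<2^k = k , n+1<2^k , ℕₚ.≤-trans 2^k≤2n (ℕₚ.*-monoʳ-≤ 2 (ℕₚ.n≤1+n (suc n)))
...   | no n+1≮2^k = suc k
        , ℕₚ.≤-<-trans n<2^k (ℕₚ.^-monoʳ-< 2 (ℕ.s≤s (ℕ.s≤s ℕ.z≤n)) (ℕₚ.n<1+n k))
        , ℕₚ.*-monoʳ-≤ 2 (ℕₚ.≮⇒≥ n+1≮2^k)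

fourthPower : ℕ → ℕ
fourthPower n = (n ℕ.* n) ℕ.* (n ℕ.* n)

-- In terms of `j = n - 6` the difference of the two sides has only positive coefficients. At
-- `n = 5` the inequality fails, 1296 against 1250.
fourthPower-suc : ∀ {n} → 6 ℕ.≤ n → fourthPower (suc n) ℕ.≤ 2 ℕ.* fourthPower n
fourthPower-suc {n} 6≤n = subst (λ n → fourthPower (suc n) ℕ.≤ 2 ℕ.* fourthPower n) (ℕₚ.m+[n∸m]≡n 6≤n)
  (subst (fourthPower (7 ℕ.+ j) ℕ.≤_) (excess j) (ℕₚ.m≤m+n _ _))
  where
  j = n ℕ.∸ 6
  excess : ∀ j → ((7 ℕ.+ j) ℕ.* (7 ℕ.+ j)) ℕ.* ((7 ℕ.+ j) ℕ.* (7 ℕ.+ j))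
    ℕ.+ (191 ℕ.+ 356 ℕ.* j ℕ.+ 138 ℕ.* (j ℕ.* j) ℕ.+ 20 ℕ.* (j ℕ.* j ℕ.* j) ℕ.+ j ℕ.* j ℕ.* (j ℕ.* j))
    ≡ 2 ℕ.* (((6 ℕ.+ j) ℕ.* (6 ℕ.+ j)) ℕ.* ((6 ℕ.+ j) ℕ.* (6 ℕ.+ j)))
  excess = ℕRing.solve-∀

-- From `k` to `suc k` the right side doubles while the left at most doubles; `5 ≤ k₀` makes
-- `fourthPower-suc` applicable to `suc k`.
fourthPower<power : ∀ c {k₀} → 5 ℕ.≤ k₀ → c ℕ.* fourthPower (suc k₀) ℕ.< 2 ℕ.^ k₀ →
  ∀ {k} → k₀ ℕ.≤ k → c ℕ.* fourthPower (suc k) ℕ.< 2 ℕ.^ k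
fourthPower<power c {k₀} 5≤k₀ base {k} k₀≤k =
  subst (λ k → c ℕ.* fourthPower (suc k) ℕ.< 2 ℕ.^ k) (ℕₚ.m∸n+n≡m k₀≤k) (above (k ℕ.∸ k₀))
  where
  open ℕₚ.≤-Reasoning
  exchange : ∀ c q → c ℕ.* (2 ℕ.* q) ≡ 2 ℕ.* (c ℕ.* q)
  exchange = ℕRing.solve-∀
  above : ∀ j → c ℕ.* fourthPower (suc (j ℕ.+ k₀)) ℕ.< 2 ℕ.^ (j ℕ.+ k₀)
  above zero = base
  above (suc j) = begin-strict
    c ℕ.* fourthPower (suc (suc (j ℕ.+ k₀)))
      ≤⟨ ℕₚ.*-monoʳ-≤ c (fourthPower-suc (ℕ.s≤s (ℕₚ.≤-trans 5≤k₀ (ℕₚ.m≤n+m k₀ j)))) ⟩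
    c ℕ.* (2 ℕ.* fourthPower (suc (j ℕ.+ k₀)))       ≡⟨ exchange c (fourthPower (suc (j ℕ.+ k₀))) ⟩
    2 ℕ.* (c ℕ.* fourthPower (suc (j ℕ.+ k₀)))       <⟨ ℕₚ.*-monoʳ-< 2 (above j) ⟩
    2 ℕ.* 2 ℕ.^ (j ℕ.+ k₀)                           ∎

-- 55296 = 8 · 3 · 48².
particles-≤-fourthPower : ∀ m n s → m ℕ.≤ 48 ℕ.* (n ℕ.* n) ℕ.* s → s ℕ.* s ℕ.≤ 3 ℕ.* m →
  8 ℕ.* m ℕ.≤ 55296 ℕ.* fourthPower n
particles-≤-fourthPower zero n s _ _ = ℕ.z≤n
particles-≤-fourthPower m@(suc _) n s m≤ s²≤3m = subst (8 ℕ.* m ℕ.≤_) (sym (ℕₚ.*-assoc 8 6912 (fourthPower n)))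
  (ℕₚ.*-monoʳ-≤ 8 (ℕₚ.*-cancelʳ-≤ m (6912 ℕ.* fourthPower n) m (begin
    m ℕ.* m                                               ≤⟨ ℕₚ.*-mono-≤ m≤ m≤ ⟩
    48 ℕ.* (n ℕ.* n) ℕ.* s ℕ.* (48 ℕ.* (n ℕ.* n) ℕ.* s)   ≡⟨ collect 48 (n ℕ.* n) s ⟩
    48 ℕ.* 48 ℕ.* fourthPower n ℕ.* (s ℕ.* s)
      ≤⟨ ℕₚ.*-monoʳ-≤ (48 ℕ.* 48 ℕ.* fourthPower n) s²≤3m ⟩
    48 ℕ.* 48 ℕ.* fourthPower n ℕ.* (3 ℕ.* m)             ≡⟨ regroup (48 ℕ.* 48) (fourthPower n) 3 m ⟩
    48 ℕ.* 48 ℕ.* 3 ℕ.* fourthPower n ℕ.* m               ∎)))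
  where
  open ℕₚ.≤-Reasoning
  collect : ∀ c p s → c ℕ.* p ℕ.* s ℕ.* (c ℕ.* p ℕ.* s) ≡ c ℕ.* c ℕ.* (p ℕ.* p) ℕ.* (s ℕ.* s)
  collect = ℕRing.solve-∀
  regroup : ∀ c q d m → c ℕ.* q ℕ.* (d ℕ.* m) ≡ c ℕ.* d ℕ.* q ℕ.* m
  regroup = ℕRing.solve-∀

-- Occupation of the disc

origin-occupied : ∀ {ord m σ} → Deposited ord (suc m) σ → Occupied σ origin
origin-occupied (add _ (stop {σ} _)) = zero , update-at σ origin (just zero)
origin-occupied (add _ walk@(move σ≡ _)) = walk-occupied walk {origin} (_ , σ≡)

norm-bounded : ∀ x → Bounded (norm x) x
norm-bounded (a , b) =
  ℕₚ.≤-trans (n≤n*n ℤ.∣ a ∣) (ℕₚ.m≤m+n (ℤ.∣ a ∣ ℕ.* ℤ.∣ a ∣) (ℤ.∣ b ∣ ℕ.* ℤ.∣ b ∣)) ,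
  ℕₚ.≤-trans (n≤n*n ℤ.∣ b ∣) (ℕₚ.m≤n+m (ℤ.∣ b ∣ ℕ.* ℤ.∣ b ∣) (ℤ.∣ a ∣ ℕ.* ℤ.∣ a ∣))

-- If `x` were free, `m ≤ 48 (k + 1)² s` and `s² ≤ 3m` for `s = norm x` would give
-- `2 ^ k ≤ 8m ≤ 55296 (k + 1)⁴`. This is false at `k = 40` by computation, and hence for all larger
-- `k`.
inner-occupied : ∀ {ord} → Injective _≡_ _≡_ ord → ∀ {m σ} → 2 ℕ.^ 40 ℕ.≤ m → Deposited ord m σ →
  ∀ x → norm x ℕ.* norm x ℕ.≤ 3 ℕ.* m → σ x ≢ nothing
inner-occupied _ {zero} 2^40≤m = ⊥-elim (ℕₚ.<⇒≱ (ℕₚ.m^n>0 2 40) 2^40≤m)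
inner-occupied {ord} ord-inj {m@(suc m-1)} {σ} 2^40≤m deposited x s²≤3m x-free
  -- The successor of this argument is `m + 3m`: the box around `x` must cover the reach `m` of the
  -- occupied sites plus the coordinates of `x`, at most `norm x ≤ 3m`.
  with power-above (m-1 ℕ.+ 3 ℕ.* m)
... | k , 4m<2^k , 2^k≤8m = ℕₚ.<⇒≱ (fourthPower<power 55296 (ℕₚ.m≤m+n 5 35)
      (toWitness {a? = 55296 ℕ.* fourthPower 41 ℕₚ.<? 2 ℕ.^ 40} _) 40≤k) (begin
    2 ℕ.^ k                         ≤⟨ 2^k≤8m ⟩
    2 ℕ.* (m ℕ.+ 3 ℕ.* m)           ≡⟨ eightfold m ⟩
    8 ℕ.* m                         ≤⟨ particles-≤-fourthPower m (suc k) (norm x) m≤ s²≤3m ⟩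
    55296 ℕ.* fourthPower (suc k)   ∎)
  where
  open ℕₚ.≤-Reasoning
  open Estimate ord ord-inj x
  s≤3m : norm x ℕ.≤ 3 ℕ.* m
  s≤3m = ℕₚ.≤-trans (n≤n*n (norm x)) s²≤3m
  -- At the centre `φₓ origin` is the pole value and not a reciprocal of the norm, so that site is
  -- settled directly: the origin is occupied once a particle has been deposited.
  s≢0 : norm x ≢ 0
  s≢0 s≡0 with refl ← norm≡0⇒≡origin x s≡0 = nothing≢just (trans (sym x-free) (proj₂ (origin-occupied deposited)))
  m≤ : m ℕ.≤ 48 ℕ.* (suc k ℕ.* suc k) ℕ.* norm x
  m≤ = free⇒particles-≤ k deposited x-free s≢0 (norm-bounded x)
    (ℕₚ.≤-<-trans (ℕₚ.+-monoʳ-≤ m s≤3m) 4m<2^k)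
  40≤k : 40 ℕ.≤ k
  40≤k = ℕₚ.≮⇒≥ (λ k<40 → ℕₚ.<⇒≱ (ℕₚ.^-monoʳ-< 2 (ℕ.s≤s (ℕ.s≤s ℕ.z≤n)) k<40)
    (ℕₚ.≤-trans 2^40≤m (ℕₚ.≤-trans (ℕₚ.m≤m+n m (3 ℕ.* m)) (ℕₚ.<⇒≤ 4m<2^k))))
  eightfold : ∀ m → 2 ℕ.* (m ℕ.+ 3 ℕ.* m) ≡ 8 ℕ.* m
  eightfold = ℕRing.solve-∀

theorem4p6 : (ord : Fin 4 → Dir) → Injective _≡_ _≡_ ord →
    (ε : ℚ) → 0ℚ < ε →
    ∃ λ (M : ℕ) → (m : ℕ) → m ≥ M →
    ∃ λ (σ : State) → Deposited ord m σ ×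
    ((x : Site) → InDisc m ε x → Occupied σ x)
-- From `2 ^ 40 ≤ m < 2 ^ k` the exponent `k` of the box exceeds the point where powers of two
-- overtake `55296 (k + 1)⁴`.
theorem4p6 ord ord-inj ε 0<ε = 2 ℕ.^ 40 , λ m m≥M →
  let σ , deposited = Existence.deposited-exists ord ord-inj m in
  σ , deposited , λ x x∈disc →
    not-nothing (σ x) (inner-occupied ord-inj m≥M deposited x (disc⇒norm² {m} x 0<ε x∈disc))
  where
  not-nothing : ∀ (w : Maybe (Fin 4)) → w ≢ nothing → ∃ λ i → w ≡ just i
  not-nothing nothing w≢nothing = ⊥-elim (w≢nothing refl)
  not-nothing (just i) _ = i , refl
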